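{- Let $G$ be a finite simple undirected connected graph with $n\ge 2$ vertices and $m$ edges, let $q$ be the largest eigenvalue of its signless Laplacian, and let $\gamma=\frac{qn}{4m}$. Then $$\gamma\le\frac{n^2}{4(n-1)}.$$ This bound is exact (i.e. equality holds) for star graphs $K_{1,n-1}$, which have $q=n$.
   Context: The signless Laplacian of $G$ is the matrix $D+A$, where $A$ is the adjacency matrix of $G$ and $D$ is the diagonal matrix of vertex degrees. The quantity $\gamma=\frac{q}{2d}=\frac{qn}{4m}$, where $d=2m/n$ is the average degree, is a spectral measure of the irregularity of $G$, defined for graphs with at least one edge. -}

module Defs where

open import Algebra.Bundles.Raw using (RawMonoid)
import Algebra.Definitions.RawMonoid as RawMonoidDefs
open import Data.Fin.Base as Fin using (Fin; toℕ)
import Data.Fin.Properties as Fin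
open import Data.Integer.Base using (+_)
open import Data.Nat.Base as ℕ using (ℕ; zero; suc; NonZero; _⊔_)
import Data.Nat.Properties as ℕ
open import Data.Product.Base using (_×_; _,_; ∃; ∃-syntax)
open import Data.Rational.Base as ℚ using (ℚ; 0ℚ; 1ℚ; ½; ∣_∣; 1/_; Positive; positive)
import Data.Rational.Properties as ℚ
open import Data.Rational.Solver using (module +-*-Solver)
open import Data.Sum.Base using (_⊎_; inj₁; inj₂)
open import Data.Vec.Functional using (Vector)
open import Function.Base using (_∘_)
open import Level using (0ℓ)
open import Relation.Binary.Construct.Closure.ReflexiveTransitive using (Star; ε; _◅_)
open import Relation.Binary.Core using (Rel)
open import Relation.Binary.Definitions
  using (Decidable; Irreflexive; Symmetric; tri<; tri≈; tri>)
open import Relation.Binary.PropositionalEquality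
  using (_≡_; _≢_; refl; sym; trans; cong; cong₂; subst)
open import Relation.Nullary using (¬_; Dec; yes; no; ¬?; _×-dec_; _⊎-dec_)
open import Relation.Nullary.Negation using (contradiction)

-- A real is a Cauchy sequence of rationals with a modulus of convergence;
-- equality of reals is the setoid equality _≈_, not _≡_.

IsCauchy : (ℕ → ℚ) → Set
IsCauchy s = ∀ δ → 0ℚ ℚ.< δ →
  ∃[ N ] ∀ i j → N ℕ.≤ i → N ℕ.≤ j → ∣ s i ℚ.- s j ∣ ℚ.< δ

record ℝ : Set where
  constructor mkℝ
  field
    seq    : ℕ → ℚ
    cauchy : IsCauchy seq

open ℝ public

infix 4 _≈_ _<_ _≤_

_≈_ : Rel ℝ 0ℓ
x ≈ y = ∀ δ → 0ℚ ℚ.< δ → ∃[ N ] ∀ i → N ℕ.≤ i → ∣ seq x i ℚ.- seq y i ∣ ℚ.< δ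

_<_ : Rel ℝ 0ℓ
x < y = ∃[ δ ] (0ℚ ℚ.< δ × ∃[ N ] ∀ i → N ℕ.≤ i → seq x i ℚ.+ δ ℚ.≤ seq y i)

_≤_ : Rel ℝ 0ℓ
x ≤ y = ¬ (y < x)

fromℚ : ℚ → ℝ
fromℚ p = mkℝ (λ _ → p) λ δ 0<δ →
  0 , λ _ _ _ _ → subst (λ r → ∣ r ∣ ℚ.< δ) (sym (ℚ.+-inverseʳ p)) 0<δ

fromℕ : ℕ → ℝ
fromℕ k = fromℚ (+ k ℚ./ 1)

abstract
  half-pos : ∀ {δ} → 0ℚ ℚ.< δ → 0ℚ ℚ.< ½ ℚ.* δ
  half-pos {δ} 0<δ =
    ℚ.positive⁻¹ (½ ℚ.* δ) {{ℚ.pos*pos⇒pos ½ δ {{positive 0<δ}}}}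

  halves : ∀ δ → ½ ℚ.* δ ℚ.+ ½ ℚ.* δ ≡ δ
  halves δ = trans (sym (ℚ.*-distribʳ-+ δ ½ ½)) (ℚ.*-identityˡ δ)

  +-cauchy : ∀ s t → IsCauchy s → IsCauchy t → IsCauchy (λ i → s i ℚ.+ t i)
  +-cauchy s t cs ct δ 0<δ =
    let M , hs = cs (½ ℚ.* δ) (half-pos 0<δ)
        N , ht = ct (½ ℚ.* δ) (half-pos 0<δ)
    in M ⊔ N , λ i j ≤i ≤j → begin-strict
      ∣ (s i ℚ.+ t i) ℚ.- (s j ℚ.+ t j) ∣
        ≡⟨ cong ∣_∣ (rearrange (s i) (t i) (s j) (t j)) ⟩
      ∣ (s i ℚ.- s j) ℚ.+ (t i ℚ.- t j) ∣
        ≤⟨ ℚ.∣p+q∣≤∣p∣+∣q∣ (s i ℚ.- s j) (t i ℚ.- t j) ⟩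
      ∣ s i ℚ.- s j ∣ ℚ.+ ∣ t i ℚ.- t j ∣
        <⟨ ℚ.+-mono-<
             (hs i j (ℕ.m⊔n≤o⇒m≤o M N ≤i) (ℕ.m⊔n≤o⇒m≤o M N ≤j))
             (ht i j (ℕ.m⊔n≤o⇒n≤o M N ≤i) (ℕ.m⊔n≤o⇒n≤o M N ≤j)) ⟩
      ½ ℚ.* δ ℚ.+ ½ ℚ.* δ
        ≡⟨ halves δ ⟩
      δ ∎
    where
    open ℚ.≤-Reasoning
    rearrange : ∀ a b c d → (a ℚ.+ b) ℚ.- (c ℚ.+ d) ≡ (a ℚ.- c) ℚ.+ (b ℚ.- d)
    rearrange = solve 4 (λ a b c d →
      (a :+ b) :- (c :+ d) := (a :- c) :+ (b :- d)) refl
      where open +-*-Solver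

  eventually-bounded : ∀ s → IsCauchy s →
    ∃[ B ] (0ℚ ℚ.≤ B × ∃[ N ] ∀ i → N ℕ.≤ i → ∣ s i ∣ ℚ.≤ B)
  eventually-bounded s cs =
    let N , h = cs 1ℚ (ℚ.positive⁻¹ 1ℚ)
    in 1ℚ ℚ.+ ∣ s N ∣
     , ℚ.+-mono-≤ (ℚ.<⇒≤ (ℚ.positive⁻¹ 1ℚ)) (ℚ.0≤∣p∣ (s N))
     , N
     , λ i N≤i → begin
         ∣ s i ∣                     ≡⟨ cong ∣_∣ (split (s i) (s N)) ⟩
         ∣ (s i ℚ.- s N) ℚ.+ s N ∣   ≤⟨ ℚ.∣p+q∣≤∣p∣+∣q∣ (s i ℚ.- s N) (s N) ⟩
         ∣ s i ℚ.- s N ∣ ℚ.+ ∣ s N ∣ ≤⟨ ℚ.+-monoˡ-≤ ∣ s N ∣ (ℚ.<⇒≤ (h i N N≤i ℕ.≤-refl)) ⟩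
         1ℚ ℚ.+ ∣ s N ∣              ∎
    where
    open ℚ.≤-Reasoning
    split : ∀ a b → a ≡ (a ℚ.- b) ℚ.+ b
    split = solve 2 (λ a b → a := (a :- b) :+ b) refl
      where open +-*-Solver

  *-cauchy : ∀ s t → IsCauchy s → IsCauchy t → IsCauchy (λ i → s i ℚ.* t i)
  *-cauchy s t cs ct δ 0<δ =
    let B₁ , 0≤B₁ , M₁ , s≤B₁ = eventually-bounded s cs
        B₂ , 0≤B₂ , M₂ , t≤B₂ = eventually-bounded t ct
        η , 0<η , small = scale (B₁ ℚ.+ B₂) (ℚ.+-mono-≤ 0≤B₁ 0≤B₂)
        N₁ , hs = cs η 0<η
        N₂ , ht = ct η 0<η
    in (M₁ ⊔ M₂) ⊔ (N₁ ⊔ N₂) , λ i j ≤i ≤j →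
      let M≤i = ℕ.m⊔n≤o⇒m≤o (M₁ ⊔ M₂) (N₁ ⊔ N₂) ≤i
          N≤i = ℕ.m⊔n≤o⇒n≤o (M₁ ⊔ M₂) (N₁ ⊔ N₂) ≤i
          M≤j = ℕ.m⊔n≤o⇒m≤o (M₁ ⊔ M₂) (N₁ ⊔ N₂) ≤j
          N≤j = ℕ.m⊔n≤o⇒n≤o (M₁ ⊔ M₂) (N₁ ⊔ N₂) ≤j
      in begin-strict
      ∣ s i ℚ.* t i ℚ.- s j ℚ.* t j ∣
        ≡⟨ cong ∣_∣ (rearrange (s i) (t i) (s j) (t j)) ⟩
      ∣ s i ℚ.* (t i ℚ.- t j) ℚ.+ t j ℚ.* (s i ℚ.- s j) ∣
        ≤⟨ ℚ.∣p+q∣≤∣p∣+∣q∣ (s i ℚ.* (t i ℚ.- t j)) (t j ℚ.* (s i ℚ.- s j)) ⟩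
      ∣ s i ℚ.* (t i ℚ.- t j) ∣ ℚ.+ ∣ t j ℚ.* (s i ℚ.- s j) ∣
        ≤⟨ ℚ.+-mono-≤
             (mult (s i) (t i ℚ.- t j) B₁ η 0<η (s≤B₁ i (ℕ.m⊔n≤o⇒m≤o M₁ M₂ M≤i))
               (ht i j (ℕ.m⊔n≤o⇒n≤o N₁ N₂ N≤i) (ℕ.m⊔n≤o⇒n≤o N₁ N₂ N≤j)))
             (mult (t j) (s i ℚ.- s j) B₂ η 0<η (t≤B₂ j (ℕ.m⊔n≤o⇒n≤o M₁ M₂ M≤j))
               (hs i j (ℕ.m⊔n≤o⇒m≤o N₁ N₂ N≤i) (ℕ.m⊔n≤o⇒m≤o N₁ N₂ N≤j))) ⟩
      B₁ ℚ.* η ℚ.+ B₂ ℚ.* η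
        ≡⟨ sym (ℚ.*-distribʳ-+ η B₁ B₂) ⟩
      (B₁ ℚ.+ B₂) ℚ.* η
        <⟨ small ⟩
      δ ∎
    where
    open ℚ.≤-Reasoning

    rearrange : ∀ a b c d →
      (a ℚ.* b) ℚ.- (c ℚ.* d) ≡ a ℚ.* (b ℚ.- d) ℚ.+ d ℚ.* (a ℚ.- c)
    rearrange = solve 4 (λ a b c d →
      (a :* b) :- (c :* d) := a :* (b :- d) :+ d :* (a :- c)) refl
      where open +-*-Solver

    mult : ∀ p r B η → 0ℚ ℚ.< η → ∣ p ∣ ℚ.≤ B → ∣ r ∣ ℚ.< η → ∣ p ℚ.* r ∣ ℚ.≤ B ℚ.* η
    mult p r B η 0<η p≤ r< = begin
      ∣ p ℚ.* r ∣     ≡⟨ ℚ.∣p*q∣≡∣p∣*∣q∣ p r ⟩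
      ∣ p ∣ ℚ.* ∣ r ∣ ≤⟨ ℚ.*-monoˡ-≤-nonNeg ∣ p ∣ {{ℚ.nonNegative (ℚ.0≤∣p∣ p)}} (ℚ.<⇒≤ r<) ⟩
      ∣ p ∣ ℚ.* η     ≤⟨ ℚ.*-monoʳ-≤-nonNeg η {{ℚ.nonNegative (ℚ.<⇒≤ 0<η)}} p≤ ⟩
      B ℚ.* η         ∎

    scale : ∀ B → 0ℚ ℚ.≤ B → ∃[ η ] (0ℚ ℚ.< η × B ℚ.* η ℚ.< δ)
    scale B 0≤B = η , 0<η , (begin-strict
      B ℚ.* η              ≡⟨ sym (ℚ.+-identityˡ (B ℚ.* η)) ⟩
      0ℚ ℚ.+ B ℚ.* η       <⟨ ℚ.+-monoˡ-< (B ℚ.* η) 0<η ⟩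
      η ℚ.+ B ℚ.* η        ≡⟨ cong (ℚ._+ B ℚ.* η) (sym (ℚ.*-identityˡ η)) ⟩
      1ℚ ℚ.* η ℚ.+ B ℚ.* η ≡⟨ sym (ℚ.*-distribʳ-+ η 1ℚ B) ⟩
      C ℚ.* (1/ C ℚ.* δ)   ≡⟨ sym (ℚ.*-assoc C (1/ C) δ) ⟩
      C ℚ.* 1/ C ℚ.* δ     ≡⟨ cong (ℚ._* δ) (ℚ.*-inverseʳ C) ⟩
      1ℚ ℚ.* δ             ≡⟨ ℚ.*-identityˡ δ ⟩
      δ                    ∎)
      where
      C : ℚ
      C = 1ℚ ℚ.+ B

      instance
        C>0 : Positive C
        C>0 = positive (ℚ.+-mono-<-≤ (ℚ.positive⁻¹ 1ℚ) 0≤B)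

        C≢0 : ℚ.NonZero C
        C≢0 = ℚ.pos⇒nonZero C

      η : ℚ
      η = 1/ C ℚ.* δ

      0<η : 0ℚ ℚ.< η
      0<η = ℚ.positive⁻¹ η
        {{ℚ.pos*pos⇒pos (1/ C) {{ℚ.1/pos⇒pos C}} δ {{positive 0<δ}}}}

infixl 6 _+_
infixl 7 _*_ _÷_

_+_ : ℝ → ℝ → ℝ
x + y = mkℝ (λ i → seq x i ℚ.+ seq y i) (+-cauchy (seq x) (seq y) (cauchy x) (cauchy y))

_*_ : ℝ → ℝ → ℝ
x * y = mkℝ (λ i → seq x i ℚ.* seq y i) (*-cauchy (seq x) (seq y) (cauchy x) (cauchy y))

_÷_ : ℝ → (k : ℕ) .{{_ : NonZero k}} → ℝ
x ÷ k = x * fromℚ (+ 1 ℚ./ k)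

+-0-rawMonoid : RawMonoid 0ℓ 0ℓ
+-0-rawMonoid = record { Carrier = ℝ ; _≈_ = _≈_ ; _∙_ = _+_ ; ε = fromℕ 0 }

sumℕ : ∀ {n} → Vector ℕ n → ℕ
sumℕ = RawMonoidDefs.sum ℕ.+-0-rawMonoid

sumℝ : ∀ {n} → Vector ℝ n → ℝ
sumℝ = RawMonoidDefs.sum +-0-rawMonoid

Matrix : Set → ℕ → Set
Matrix A n = Fin n → Fin n → A

infixr 7 _*ᵥ_

_*ᵥ_ : ∀ {n} → Matrix ℝ n → Vector ℝ n → Vector ℝ n
(M *ᵥ x) u = sumℝ λ v → M u v * x v

IsEigenvalue : ∀ {n} → Matrix ℝ n → ℝ → Set
IsEigenvalue M μ = ∃[ x ] (¬ (∀ u → x u ≈ fromℕ 0) × ∀ u → (M *ᵥ x) u ≈ μ * x u)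

IsLargestEigenvalue : ∀ {n} → Matrix ℝ n → ℝ → Set
IsLargestEigenvalue M q = IsEigenvalue M q × (∀ μ → IsEigenvalue M μ → μ ≤ q)

record Graph (n : ℕ) : Set₁ where
  field
    Adj    : Rel (Fin n) 0ℓ
    adj?   : Decidable Adj
    symm   : Symmetric Adj
    irrefl : Irreflexive _≡_ Adj

[_] : {P : Set} → Dec P → ℕ
[ yes _ ] = 1
[ no  _ ] = 0

module _ {n : ℕ} (G : Graph n) where
  open Graph G

  Connected : Set
  Connected = ∀ u v → Star Adj u v

  degree : Fin n → ℕ
  degree u = sumℕ λ v → [ adj? u v ]

  -- Each edge is counted at its ordered pair of endpoints u < v.
  size : ℕ
  size = sumℕ λ u → sumℕ λ v → [ (u Fin.<? v) ×-dec adj? u v ]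

  adjacencyMatrix : Matrix ℕ n
  adjacencyMatrix u v = [ adj? u v ]

  degreeMatrix : Matrix ℕ n
  degreeMatrix u v = [ u Fin.≟ v ] ℕ.* degree u

  signlessLaplacian : Matrix ℝ n
  signlessLaplacian u v = fromℕ (degreeMatrix u v) + fromℕ (adjacencyMatrix u v)

  -- γ = q n / (4 m); the argument q is the largest signless Laplacian eigenvalue.
  γ : .{{_ : NonZero size}} → ℝ → ℝ
  γ q = (q * fromℕ n) ÷ (4 ℕ.* size)
    where instance _ = ℕ.m*n≢0 4 size

term≤sumℕ : ∀ {n} (f : Vector ℕ n) i → f i ℕ.≤ sumℕ f
term≤sumℕ f Fin.zero    = ℕ.m≤m+n _ _
term≤sumℕ f (Fin.suc i) = ℕ.≤-trans (term≤sumℕ (f ∘ Fin.suc) i) (ℕ.m≤n+m _ _)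

[yes] : {P : Set} (d : Dec P) → P → 1 ℕ.≤ [ d ]
[yes] (yes _) _ = ℕ.≤-refl
[yes] (no ¬p) p = contradiction p ¬p

ordered : ∀ {n} (G : Graph n) {a b} → a Fin.< b → Graph.Adj G a b → 1 ℕ.≤ size G
ordered G {a} {b} a<b ab =
  ℕ.≤-trans ([yes] ((a Fin.<? b) ×-dec Graph.adj? G a b) (a<b , ab))
    (ℕ.≤-trans (term≤sumℕ (λ v → [ (a Fin.<? v) ×-dec Graph.adj? G a v ]) b)
      (term≤sumℕ (λ u → sumℕ λ v → [ (u Fin.<? v) ×-dec Graph.adj? G u v ]) a))

edge⇒size≢0 : ∀ {n} (G : Graph n) {u v} → Graph.Adj G u v → NonZero (size G)
edge⇒size≢0 G {u} {v} uv with Fin.<-cmp u v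
... | tri< u<v _ _ = ℕ.>-nonZero (ordered G u<v uv)
... | tri≈ _ u≡v _ = contradiction uv (Graph.irrefl G u≡v)
... | tri> _ _ v<u = ℕ.>-nonZero (ordered G v<u (Graph.symm G uv))

connected⇒size≢0 : ∀ {n} → 2 ℕ.≤ n → (G : Graph n) → Connected G → NonZero (size G)
connected⇒size≢0 (ℕ.s≤s (ℕ.s≤s _)) G conn with conn Fin.zero (Fin.suc Fin.zero)
... | e ◅ _ = edge⇒size≢0 G e

4[n∸1]≢0 : ∀ {n} → 2 ℕ.≤ n → NonZero (4 ℕ.* (n ℕ.∸ 1))
4[n∸1]≢0 (ℕ.s≤s (ℕ.s≤s _)) = _

-- The star K_{1,n-1}, centred at the vertex with index 0.
starGraph : ∀ n → Graph n
starGraph n = record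
  { Adj    = λ u v → (toℕ u ≡ 0 × toℕ v ≢ 0) ⊎ (toℕ u ≢ 0 × toℕ v ≡ 0)
  ; adj?   = λ u v → ((toℕ u ℕ.≟ 0) ×-dec ¬? (toℕ v ℕ.≟ 0))
                     ⊎-dec (¬? (toℕ u ℕ.≟ 0) ×-dec (toℕ v ℕ.≟ 0))
  ; symm   = λ { (inj₁ (u≡0 , v≢0)) → inj₂ (v≢0 , u≡0)
               ; (inj₂ (u≢0 , v≡0)) → inj₁ (v≡0 , u≢0) }
  ; irrefl = λ { refl (inj₁ (u≡0 , u≢0)) → u≢0 u≡0
               ; refl (inj₂ (u≢0 , u≡0)) → u≢0 u≡0 }
  }

starGraph-connected : ∀ n → Connected (starGraph n)
starGraph-connected (suc n) Fin.zero    Fin.zero    = ε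
starGraph-connected (suc n) Fin.zero    (Fin.suc v) = inj₁ (refl , λ ()) ◅ ε
starGraph-connected (suc n) (Fin.suc u) Fin.zero    = inj₂ ((λ ()) , refl) ◅ ε
starGraph-connected (suc n) (Fin.suc u) (Fin.suc v) =
  _◅_ {j = Fin.zero} (inj₂ ((λ ()) , refl)) (inj₁ (refl , λ ()) ◅ ε)

{-# OPTIONS --safe #-}

-- If a positive vector w satisfies wᵀM ≤ C wᵀ for a nonnegative matrix M, then
-- pairing |μ| |x| ≤ M |x| with w gives μ ≤ C for every eigenvalue μ of M. Take for
-- M the signless Laplacian and for w the degree vector d: with N = n − 1 and
-- T u the sum of the degrees of the neighbours of u, the choice C = n m / N needs
-- N (d u² + T u) ≤ n m d u. This follows from T u ≤ 2m − N when d u ≥ 2, from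
-- T u ≤ N when d u = 1, and from m ≥ N, which holds by connectedness. So
-- q ≤ n m / N, which is the bound on γ. For the star the inequality is an
-- equality at every vertex, so d is an eigenvector for n.

module Submission where

open import Defs
open import Algebra.Bundles using (CommutativeRing)
import Algebra.Properties.Semiring.Sum as SemiringSum
open import Data.Fin.Base as Fin using (Fin)
import Data.Fin.Properties as Fin
open import Data.Integer.Base as ℤ using (+_)
import Data.Integer.Properties as ℤ
open import Data.Nat.Base as ℕ using (ℕ; zero; suc; NonZero; _⊔_; s≤s; z≤n)
import Data.Nat.Properties as ℕ
import Data.Nat.Solver as ℕ
open import Data.Product.Base using (_×_; _,_; ∃-syntax; proj₁; proj₂)
open import Data.Rational.Base as ℚ using (ℚ; 0ℚ; 1ℚ; ½; ∣_∣; 1/_)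
import Data.Rational.Properties as ℚ
import Data.Rational.Solver as ℚ
open import Data.Rational.Unnormalised.Base as ℚᵘ using (mkℚᵘ; *≡*)
import Data.Rational.Unnormalised.Properties as ℚᵘ
open import Data.Sum.Base using (inj₁; inj₂)
open import Data.Vec.Functional using (Vector)
open import Function.Base using (_∘_)
open import Relation.Binary.Construct.Closure.ReflexiveTransitive using (Star; ε; _◅_)
open import Relation.Binary.Definitions using (tri<; tri≈; tri>)
open import Relation.Binary.PropositionalEquality
  using (_≡_; _≢_; refl; sym; trans; cong; cong₂; subst; module ≡-Reasoning)
open import Relation.Nullary using (¬_; Dec; yes; no; _×-dec_)
open import Relation.Nullary.Negation using (contradiction)

-- Embedding of the naturals in the rationals

module Σℕ = SemiringSum ℕ.+-*-semiring
module Σℚ = SemiringSum (CommutativeRing.semiring ℚ.+-*-commutativeRing)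

open Σℚ using () renaming (sum to sumℚ)

-- Every term of `fromℕ k` is definitionally this rational, so identities about `ι` apply termwise
-- to such reals.
ι : ℕ → ℚ
ι k = + k ℚ./ 1

-- The normalised fraction `ι k` does not compute for a variable `k`. The arithmetic laws below pass
-- to unnormalised fractions, where they are integer identities.
toℚᵘ-ι : ∀ k → ℚ.toℚᵘ (ι k) ℚᵘ.≃ mkℚᵘ (+ k) 0
toℚᵘ-ι k = ℚ.toℚᵘ-fromℚᵘ (mkℚᵘ (+ k) 0)

ι-+ : ∀ a b → ι (a ℕ.+ b) ≡ ι a ℚ.+ ι b
ι-+ a b = ℚ.toℚᵘ-injective (begin
  ℚ.toℚᵘ (ι (a ℕ.+ b))              ≈⟨ toℚᵘ-ι (a ℕ.+ b) ⟩
  mkℚᵘ (+ (a ℕ.+ b)) 0              ≈⟨ *≡* (cong (ℤ._* + 1)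
      (sym (cong₂ ℤ._+_ (ℤ.*-identityʳ (+ a)) (ℤ.*-identityʳ (+ b))))) ⟩
  mkℚᵘ (+ a) 0 ℚᵘ.+ mkℚᵘ (+ b) 0    ≈⟨ ℚᵘ.+-cong (toℚᵘ-ι a) (toℚᵘ-ι b) ⟨
  ℚ.toℚᵘ (ι a) ℚᵘ.+ ℚ.toℚᵘ (ι b)    ≈⟨ ℚ.toℚᵘ-homo-+ (ι a) (ι b) ⟨
  ℚ.toℚᵘ (ι a ℚ.+ ι b)              ∎)
  where open ℚᵘ.≃-Reasoning

ι-* : ∀ a b → ι (a ℕ.* b) ≡ ι a ℚ.* ι b
ι-* a b = ℚ.toℚᵘ-injective (begin
  ℚ.toℚᵘ (ι (a ℕ.* b))              ≈⟨ toℚᵘ-ι (a ℕ.* b) ⟩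
  mkℚᵘ (+ (a ℕ.* b)) 0              ≈⟨ *≡* (cong (ℤ._* + 1) (ℤ.pos-* a b)) ⟩
  mkℚᵘ (+ a) 0 ℚᵘ.* mkℚᵘ (+ b) 0    ≈⟨ ℚᵘ.*-cong (toℚᵘ-ι a) (toℚᵘ-ι b) ⟨
  ℚ.toℚᵘ (ι a) ℚᵘ.* ℚ.toℚᵘ (ι b)    ≈⟨ ℚ.toℚᵘ-homo-* (ι a) (ι b) ⟨
  ℚ.toℚᵘ (ι a ℚ.* ι b)              ∎)
  where open ℚᵘ.≃-Reasoning

ι-*-1/ : ∀ k .{{_ : NonZero k}} → ι k ℚ.* (+ 1 ℚ./ k) ≡ 1ℚ
ι-*-1/ k@(suc j) = ℚ.toℚᵘ-injective (begin
  ℚ.toℚᵘ (ι k ℚ.* (+ 1 ℚ./ k))              ≈⟨ ℚ.toℚᵘ-homo-* (ι k) (+ 1 ℚ./ k) ⟩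
  ℚ.toℚᵘ (ι k) ℚᵘ.* ℚ.toℚᵘ (+ 1 ℚ./ k)      ≈⟨ ℚᵘ.*-cong (toℚᵘ-ι k) (ℚ.toℚᵘ-fromℚᵘ (mkℚᵘ (+ 1) j)) ⟩
  mkℚᵘ (+ k) 0 ℚᵘ.* mkℚᵘ (+ 1) j            ≈⟨ *≡* 
      (trans (cong (ℤ._* + 1) (ℤ.*-identityʳ (+ k)))
        (trans (ℤ.*-identityʳ (+ k))
          (sym (trans (ℤ.*-identityˡ _) (cong +_ (ℕ.*-identityˡ k)))))) ⟩
  ℚ.toℚᵘ 1ℚ                                 ∎)
  where open ℚᵘ.≃-Reasoning

0≤ι : ∀ k → 0ℚ ℚ.≤ ι k
0≤ι k = ℚ.toℚᵘ-cancel-≤ (ℚᵘ.≤-trans (ℚᵘ.nonNegative⁻¹ (mkℚᵘ (+ k) 0)) (ℚᵘ.≤-reflexive (ℚᵘ.≃-sym (toℚᵘ-ι k))))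

ι-mono-≤ : ∀ {a b} → a ℕ.≤ b → ι a ℚ.≤ ι b
ι-mono-≤ {a} {b} a≤b = begin
  ι a                      ≡⟨ ℚ.+-identityʳ (ι a) ⟨
  ι a ℚ.+ 0ℚ               ≤⟨ ℚ.+-monoʳ-≤ (ι a) (0≤ι (b ℕ.∸ a)) ⟩
  ι a ℚ.+ ι (b ℕ.∸ a)      ≡⟨ ι-+ a (b ℕ.∸ a) ⟨
  ι (a ℕ.+ (b ℕ.∸ a))      ≡⟨ cong ι (ℕ.m+[n∸m]≡n a≤b) ⟩
  ι b                      ∎
  where open ℚ.≤-Reasoning

0<ι : ∀ k .{{_ : NonZero k}} → 0ℚ ℚ.< ι k
0<ι k@(suc _) = ℚ.<-≤-trans (ℚ.positive⁻¹ 1ℚ) (ι-mono-≤ {1} {k} (ℕ.s≤s ℕ.z≤n))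

ι-sum : ∀ {n} (f : Vector ℕ n) → ι (sumℕ f) ≡ sumℚ (ι ∘ f)
ι-sum {zero}  f = refl
ι-sum {suc n} f = trans (ι-+ (f Fin.zero) (sumℕ (f ∘ Fin.suc))) (cong (ι (f Fin.zero) ℚ.+_) (ι-sum (f ∘ Fin.suc)))

0<1/ : ∀ k .{{_ : NonZero k}} → 0ℚ ℚ.< + 1 ℚ./ k
0<1/ (suc k) = ℚ.positive⁻¹ _ {{ℚ.normalize-pos 1 (suc k)}}

-- Finite sums of rationals

sumℚ-mono-≤ : ∀ {n} {f g : Vector ℚ n} → (∀ i → f i ℚ.≤ g i) → sumℚ f ℚ.≤ sumℚ g
sumℚ-mono-≤ {zero}  f≤g = ℚ.≤-refl
sumℚ-mono-≤ {suc n} f≤g = ℚ.+-mono-≤ (f≤g Fin.zero) (sumℚ-mono-≤ (f≤g ∘ Fin.suc))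

sumℚ-nonNeg : ∀ {n} {f : Vector ℚ n} → (∀ i → 0ℚ ℚ.≤ f i) → 0ℚ ℚ.≤ sumℚ f
sumℚ-nonNeg {zero}  0≤f = ℚ.≤-refl
sumℚ-nonNeg {suc n} 0≤f = ℚ.+-mono-≤ (0≤f Fin.zero) (sumℚ-nonNeg (0≤f ∘ Fin.suc))

term≤sumℚ : ∀ {n} {f : Vector ℚ n} → (∀ i → 0ℚ ℚ.≤ f i) → ∀ i → f i ℚ.≤ sumℚ f
term≤sumℚ {f = f} 0≤f Fin.zero = begin
  f Fin.zero                               ≡⟨ ℚ.+-identityʳ _ ⟨
  f Fin.zero ℚ.+ 0ℚ                        ≤⟨ ℚ.+-monoʳ-≤ (f Fin.zero) (sumℚ-nonNeg (0≤f ∘ Fin.suc)) ⟩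
  f Fin.zero ℚ.+ sumℚ (f ∘ Fin.suc)        ∎
  where open ℚ.≤-Reasoning
term≤sumℚ {f = f} 0≤f (Fin.suc i) = begin
  f (Fin.suc i)                            ≤⟨ term≤sumℚ (0≤f ∘ Fin.suc) i ⟩
  sumℚ (f ∘ Fin.suc)                       ≡⟨ ℚ.+-identityˡ _ ⟨
  0ℚ ℚ.+ sumℚ (f ∘ Fin.suc)                ≤⟨ ℚ.+-monoˡ-≤ _ (0≤f Fin.zero) ⟩
  f Fin.zero ℚ.+ sumℚ (f ∘ Fin.suc)        ∎
  where open ℚ.≤-Reasoning

∣sumℚ∣≤ : ∀ {n} (f : Vector ℚ n) → ∣ sumℚ f ∣ ℚ.≤ sumℚ (∣_∣ ∘ f)
∣sumℚ∣≤ {zero}  f = ℚ.≤-refl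
∣sumℚ∣≤ {suc n} f = ℚ.≤-trans (ℚ.∣p+q∣≤∣p∣+∣q∣ (f Fin.zero) _) (ℚ.+-monoʳ-≤ ∣ f Fin.zero ∣ (∣sumℚ∣≤ (f ∘ Fin.suc)))

p≤∣p∣ : ∀ p → p ℚ.≤ ∣ p ∣
p≤∣p∣ p with ℚ.≤-total 0ℚ p
... | inj₁ 0≤p = ℚ.≤-reflexive (sym (ℚ.0≤p⇒∣p∣≡p 0≤p))
... | inj₂ p≤0 = ℚ.≤-trans p≤0 (ℚ.0≤∣p∣ p)

-- Weighted eigenvalue estimate

-- Pairing with left weights, rather than taking the largest |x u| / w u as in the
-- Collatz–Wielandt bound, avoids a maximum of reals.
weighted-residual : ∀ {n} (A : Matrix ℚ n) (w : Vector ℚ n) (C : ℚ) →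
  (∀ u v → 0ℚ ℚ.≤ A u v) → (∀ u → 0ℚ ℚ.≤ w u) →
  (∀ v → sumℚ (λ u → w u ℚ.* A u v) ℚ.≤ C ℚ.* w v) →
  ∀ (x : Vector ℚ n) μ →
  μ ℚ.* sumℚ (λ u → w u ℚ.* ∣ x u ∣) ℚ.≤
  sumℚ (λ u → w u ℚ.* ∣ sumℚ (λ v → A u v ℚ.* x v) ℚ.- μ ℚ.* x u ∣)
    ℚ.+ C ℚ.* sumℚ (λ u → w u ℚ.* ∣ x u ∣)
weighted-residual A w C 0≤A 0≤w wA≤Cw x μ = begin
  μ ℚ.* sumℚ (λ u → w u ℚ.* ∣ x u ∣)
    ≡⟨ Σℚ.*-distribˡ-sum μ (λ u → w u ℚ.* ∣ x u ∣) ⟩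
  sumℚ (λ u → μ ℚ.* (w u ℚ.* ∣ x u ∣))
    ≤⟨ sumℚ-mono-≤ row ⟩
  sumℚ (λ u → w u ℚ.* ∣ r u ∣ ℚ.+ sumℚ (λ v → w u ℚ.* A u v ℚ.* ∣ x v ∣))
    ≡⟨ Σℚ.∑-distrib-+ (λ u → w u ℚ.* ∣ r u ∣) _ ⟩
  sumℚ (λ u → w u ℚ.* ∣ r u ∣) ℚ.+ sumℚ (λ u → sumℚ (λ v → w u ℚ.* A u v ℚ.* ∣ x v ∣))
    ≤⟨ ℚ.+-monoʳ-≤ (sumℚ (λ u → w u ℚ.* ∣ r u ∣)) columns ⟩
  sumℚ (λ u → w u ℚ.* ∣ r u ∣) ℚ.+ C ℚ.* sumℚ (λ u → w u ℚ.* ∣ x u ∣) ∎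
  where
  open ℚ.≤-Reasoning
  open ℚ.+-*-Solver

  -- The defect of the eigenvalue equation. The rational terms of a real eigenvector satisfy that
  -- equation only approximately, so the estimate must carry this error.
  r : Vector ℚ _
  r u = sumℚ (λ v → A u v ℚ.* x v) ℚ.- μ ℚ.* x u

  split : ∀ a b → b ≡ a ℚ.- (a ℚ.- b)
  split = solve 2 (λ a b → b := a :- (a :- b)) refl

  -- Triangle inequality for `μ x = A x - r`, with `A` nonnegative. The sign of `μ` is unknown,
  -- hence the detour through `∣ μ ∣`.
  abs-row : ∀ u → μ ℚ.* ∣ x u ∣ ℚ.≤ ∣ r u ∣ ℚ.+ sumℚ (λ v → A u v ℚ.* ∣ x v ∣)
  abs-row u = begin
    μ ℚ.* ∣ x u ∣
      ≤⟨ ℚ.*-monoʳ-≤-nonNeg ∣ x u ∣ {{ℚ.∣-∣-nonNeg (x u)}} (p≤∣p∣ μ) ⟩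
    ∣ μ ∣ ℚ.* ∣ x u ∣
      ≡⟨ ℚ.∣p*q∣≡∣p∣*∣q∣ μ (x u) ⟨
    ∣ μ ℚ.* x u ∣
      ≡⟨ cong ∣_∣ (split (sumℚ (λ v → A u v ℚ.* x v)) (μ ℚ.* x u)) ⟩
    ∣ sumℚ (λ v → A u v ℚ.* x v) ℚ.- r u ∣
      ≤⟨ ℚ.∣p-q∣≤∣p∣+∣q∣ (sumℚ (λ v → A u v ℚ.* x v)) (r u) ⟩
    ∣ sumℚ (λ v → A u v ℚ.* x v) ∣ ℚ.+ ∣ r u ∣
      ≡⟨ ℚ.+-comm _ ∣ r u ∣ ⟩
    ∣ r u ∣ ℚ.+ ∣ sumℚ (λ v → A u v ℚ.* x v) ∣
      ≤⟨ ℚ.+-monoʳ-≤ ∣ r u ∣ (∣sumℚ∣≤ (λ v → A u v ℚ.* x v)) ⟩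
    ∣ r u ∣ ℚ.+ sumℚ (λ v → ∣ A u v ℚ.* x v ∣)
      ≡⟨ cong (∣ r u ∣ ℚ.+_) (Σℚ.sum-cong-≗ λ v →
           trans (ℚ.∣p*q∣≡∣p∣*∣q∣ (A u v) (x v))
                 (cong (ℚ._* ∣ x v ∣) (ℚ.0≤p⇒∣p∣≡p (0≤A u v)))) ⟩
    ∣ r u ∣ ℚ.+ sumℚ (λ v → A u v ℚ.* ∣ x v ∣) ∎

  row : ∀ u → μ ℚ.* (w u ℚ.* ∣ x u ∣) ℚ.≤
              w u ℚ.* ∣ r u ∣ ℚ.+ sumℚ (λ v → w u ℚ.* A u v ℚ.* ∣ x v ∣)
  row u = begin
    μ ℚ.* (w u ℚ.* ∣ x u ∣)
      ≡⟨ solve 3 (λ m a b → m :* (a :* b) := a :* (m :* b)) refl μ (w u) ∣ x u ∣ ⟩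
    w u ℚ.* (μ ℚ.* ∣ x u ∣)
      ≤⟨ ℚ.*-monoˡ-≤-nonNeg (w u) {{ℚ.nonNegative (0≤w u)}} (abs-row u) ⟩
    w u ℚ.* (∣ r u ∣ ℚ.+ sumℚ (λ v → A u v ℚ.* ∣ x v ∣))
      ≡⟨ ℚ.*-distribˡ-+ (w u) ∣ r u ∣ _ ⟩
    w u ℚ.* ∣ r u ∣ ℚ.+ w u ℚ.* sumℚ (λ v → A u v ℚ.* ∣ x v ∣)
      ≡⟨ cong (w u ℚ.* ∣ r u ∣ ℚ.+_) (trans
           (Σℚ.*-distribˡ-sum (w u) (λ v → A u v ℚ.* ∣ x v ∣))
           (Σℚ.sum-cong-≗ λ v → sym (ℚ.*-assoc (w u) (A u v) ∣ x v ∣))) ⟩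
    w u ℚ.* ∣ r u ∣ ℚ.+ sumℚ (λ v → w u ℚ.* A u v ℚ.* ∣ x v ∣) ∎

  -- Exchanging the sums brings out the column sums `w u * A u v`, which `wA≤Cw` bounds.
  columns : sumℚ (λ u → sumℚ (λ v → w u ℚ.* A u v ℚ.* ∣ x v ∣)) ℚ.≤
            C ℚ.* sumℚ (λ u → w u ℚ.* ∣ x u ∣)
  columns = begin
    sumℚ (λ u → sumℚ (λ v → w u ℚ.* A u v ℚ.* ∣ x v ∣))
      ≡⟨ Σℚ.∑-comm (λ u v → w u ℚ.* A u v ℚ.* ∣ x v ∣) ⟩
    sumℚ (λ v → sumℚ (λ u → w u ℚ.* A u v ℚ.* ∣ x v ∣))
      ≡⟨ Σℚ.sum-cong-≗ (λ v → sym (Σℚ.*-distribʳ-sum ∣ x v ∣ (λ u → w u ℚ.* A u v))) ⟩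
    sumℚ (λ v → sumℚ (λ u → w u ℚ.* A u v) ℚ.* ∣ x v ∣)
      ≤⟨ sumℚ-mono-≤ (λ v → ℚ.*-monoʳ-≤-nonNeg ∣ x v ∣ {{ℚ.∣-∣-nonNeg (x v)}} (wA≤Cw v)) ⟩
    sumℚ (λ v → C ℚ.* w v ℚ.* ∣ x v ∣)
      ≡⟨ Σℚ.sum-cong-≗ (λ v → ℚ.*-assoc C (w v) ∣ x v ∣) ⟩
    sumℚ (λ v → C ℚ.* (w v ℚ.* ∣ x v ∣))
      ≡⟨ Σℚ.*-distribˡ-sum C (λ v → w v ℚ.* ∣ x v ∣) ⟨
    C ℚ.* sumℚ (λ v → w v ℚ.* ∣ x v ∣) ∎

-- Indicators and finite sums of naturals

[]-yes : {P : Set} (d : Dec P) → P → [ d ] ≡ 1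
[]-yes (yes _) _ = refl
[]-yes (no ¬p) p = contradiction p ¬p

[]-no : {P : Set} (d : Dec P) → ¬ P → [ d ] ≡ 0
[]-no (yes p) ¬p = contradiction p ¬p
[]-no (no _)  _  = refl

[]≤1 : {P : Set} (d : Dec P) → [ d ] ℕ.≤ 1
[]≤1 (yes _) = ℕ.≤-refl
[]≤1 (no _)  = z≤n

[]-cong : {P Q : Set} (d : Dec P) (e : Dec Q) → (P → Q) → (Q → P) → [ d ] ≡ [ e ]
[]-cong (yes p) e f g = sym ([]-yes e (f p))
[]-cong (no ¬p) e f g = sym ([]-no e (¬p ∘ g))

sumℕ-mono-≤ : ∀ {n} {f g : Vector ℕ n} → (∀ i → f i ℕ.≤ g i) → sumℕ f ℕ.≤ sumℕ g
sumℕ-mono-≤ {zero}  f≤g = z≤n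
sumℕ-mono-≤ {suc n} f≤g = ℕ.+-mono-≤ (f≤g Fin.zero) (sumℕ-mono-≤ (f≤g ∘ Fin.suc))

sumℕ-1 : ∀ n → sumℕ {n} (λ _ → 1) ≡ n
sumℕ-1 zero    = refl
sumℕ-1 (suc n) = cong suc (sumℕ-1 n)

sumℕ-0 : ∀ {n} {f : Vector ℕ n} → (∀ i → f i ≡ 0) → sumℕ f ≡ 0
sumℕ-0 {n} f≡0 = trans (Σℕ.sum-cong-≗ f≡0) (Σℕ.sum-replicate-zero n)

sumℕ-δ : ∀ {n} (u : Fin n) (f : Vector ℕ n) → sumℕ (λ v → [ u Fin.≟ v ] ℕ.* f v) ≡ f u
sumℕ-δ Fin.zero f = begin
  f Fin.zero ℕ.+ 0 ℕ.+ sumℕ (λ v → [ Fin.zero Fin.≟ Fin.suc v ] ℕ.* f (Fin.suc v))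
    ≡⟨ cong₂ ℕ._+_ (ℕ.+-identityʳ _) (sumℕ-0 {f = λ v → [ Fin.zero Fin.≟ Fin.suc v ] ℕ.* f (Fin.suc v)} λ _ → refl) ⟩
  f Fin.zero ℕ.+ 0
    ≡⟨ ℕ.+-identityʳ _ ⟩
  f Fin.zero ∎
  where open ≡-Reasoning
sumℕ-δ (Fin.suc u) f = begin
  sumℕ (λ v → [ Fin.suc u Fin.≟ Fin.suc v ] ℕ.* f (Fin.suc v))
    ≡⟨ Σℕ.sum-cong-≗ (λ v → cong (ℕ._* f (Fin.suc v))
         ([]-cong (Fin.suc u Fin.≟ Fin.suc v) (u Fin.≟ v) Fin.suc-injective (cong Fin.suc))) ⟩
  sumℕ (λ v → [ u Fin.≟ v ] ℕ.* f (Fin.suc v))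
    ≡⟨ sumℕ-δ u (f ∘ Fin.suc) ⟩
  f (Fin.suc u) ∎
  where open ≡-Reasoning

sumℕ-δ-1 : ∀ {n} (u : Fin n) → sumℕ (λ v → [ u Fin.≟ v ]) ≡ 1
sumℕ-δ-1 u = trans (Σℕ.sum-cong-≗ λ v → sym (ℕ.*-identityʳ [ u Fin.≟ v ])) (sumℕ-δ u (λ _ → 1))

-- Degree sums in a graph

module _ {n} (G : Graph n) where
  open Graph G

  private
    a : Matrix ℕ n
    a = adjacencyMatrix G

    d : Vector ℕ n
    d = degree G

  neighbourDegreeSum : Vector ℕ n
  neighbourDegreeSum u = sumℕ λ v → a u v ℕ.* d v

  adjacencyMatrix-sym : ∀ u v → a u v ≡ a v u
  adjacencyMatrix-sym u v = []-cong (adj? u v) (adj? v u) symm symm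

  -- By trichotomy an adjacency entry is `e u v + e v u`, where `e` marks the ordered pairs counted
  -- by `size`; both halves have the same total.
  handshake : sumℕ d ≡ size G ℕ.+ size G
  handshake = begin
    sumℕ (λ u → sumℕ (λ v → a u v))
      ≡⟨ Σℕ.sum-cong-≗ (λ u → Σℕ.sum-cong-≗ (split u)) ⟩
    sumℕ (λ u → sumℕ (λ v → e u v ℕ.+ e v u))
      ≡⟨ Σℕ.sum-cong-≗ (λ u → Σℕ.∑-distrib-+ (e u) (λ v → e v u)) ⟩
    sumℕ (λ u → sumℕ (e u) ℕ.+ sumℕ (λ v → e v u))
      ≡⟨ Σℕ.∑-distrib-+ (λ u → sumℕ (e u)) _ ⟩
    size G ℕ.+ sumℕ (λ u → sumℕ (λ v → e v u))
      ≡⟨ cong (size G ℕ.+_) (Σℕ.∑-comm (λ u v → e v u)) ⟩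
    size G ℕ.+ size G ∎
    where
    open ≡-Reasoning

    e : Matrix ℕ n
    e u v = [ (u Fin.<? v) ×-dec adj? u v ]

    split : ∀ u v → a u v ≡ e u v ℕ.+ e v u
    split u v with Fin.<-cmp u v
    ... | tri< u<v _ v≮u = begin
      a u v              ≡⟨ []-cong (adj? u v) ((u Fin.<? v) ×-dec adj? u v) (u<v ,_) proj₂ ⟩
      e u v              ≡⟨ ℕ.+-identityʳ _ ⟨
      e u v ℕ.+ 0        ≡⟨ cong (e u v ℕ.+_) ([]-no ((v Fin.<? u) ×-dec adj? v u) (v≮u ∘ proj₁)) ⟨
      e u v ℕ.+ e v u    ∎
    ... | tri≈ u≮v u≡v v≮u = begin
      a u v              ≡⟨ []-no (adj? u v) (irrefl u≡v) ⟩
      0                  ≡⟨ cong₂ ℕ._+_ ([]-no ((u Fin.<? v) ×-dec adj? u v) (u≮v ∘ proj₁))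
                                        ([]-no ((v Fin.<? u) ×-dec adj? v u) (v≮u ∘ proj₁)) ⟨
      e u v ℕ.+ e v u    ∎
    ... | tri> u≮v _ v<u = begin
      a u v              ≡⟨ []-cong (adj? u v) ((v Fin.<? u) ×-dec adj? v u)
                              (λ uv → v<u , symm uv) (symm ∘ proj₂) ⟩
      0 ℕ.+ e v u        ≡⟨ cong (ℕ._+ e v u) ([]-no ((u Fin.<? v) ×-dec adj? u v) (u≮v ∘ proj₁)) ⟨
      e u v ℕ.+ e v u    ∎

  -- There are no loops, so adding the indicator of `u` to its adjacency row keeps all entries at
  -- most 1.
  degree<n : ∀ u → suc (d u) ℕ.≤ n
  degree<n u = begin
    suc (d u)                                ≡⟨ ℕ.+-comm 1 (d u) ⟩
    d u ℕ.+ 1                                ≡⟨ cong (d u ℕ.+_) (sumℕ-δ-1 u) ⟨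
    d u ℕ.+ sumℕ (λ v → [ u Fin.≟ v ])       ≡⟨ Σℕ.∑-distrib-+ (a u) _ ⟨
    sumℕ (λ v → a u v ℕ.+ [ u Fin.≟ v ])     ≤⟨ sumℕ-mono-≤ pointwise ⟩
    sumℕ {n} (λ _ → 1)                       ≡⟨ sumℕ-1 n ⟩
    n                                        ∎
    where
    open ℕ.≤-Reasoning
    pointwise : ∀ v → a u v ℕ.+ [ u Fin.≟ v ] ℕ.≤ 1
    pointwise v with u Fin.≟ v
    ... | yes u≡v = ℕ.≤-reflexive (cong (ℕ._+ 1) ([]-no (adj? u v) (irrefl u≡v)))
    ... | no  _   = ℕ.≤-trans (ℕ.≤-reflexive (ℕ.+-identityʳ _)) ([]≤1 (adj? u v))

  neighbourDegreeSum≤ : ∀ u → neighbourDegreeSum u ℕ.≤ d u ℕ.* (n ℕ.∸ 1)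
  neighbourDegreeSum≤ u = begin
    sumℕ (λ v → a u v ℕ.* d v)          ≤⟨ sumℕ-mono-≤ (λ v → ℕ.*-monoʳ-≤ (a u v) (ℕ.<⇒≤pred (degree<n v))) ⟩
    sumℕ (λ v → a u v ℕ.* (n ℕ.∸ 1))    ≡⟨ Σℕ.*-distribʳ-sum (n ℕ.∸ 1) (a u) ⟨
    d u ℕ.* (n ℕ.∸ 1)                   ∎
    where open ℕ.≤-Reasoning

  -- A vertex outside the neighbourhood of u contributes at least 1 to the sum of
  -- all degrees, and u itself contributes its degree.
  neighbourDegreeSum+n≤ : (∀ v → 1 ℕ.≤ d v) → ∀ u →
    neighbourDegreeSum u ℕ.+ n ℕ.≤ sumℕ d ℕ.+ 1
  neighbourDegreeSum+n≤ 1≤d u = ℕ.+-cancelʳ-≤ (d u) _ _ (begin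
    T ℕ.+ n ℕ.+ d u
      ≡⟨ cong₂ (λ s t → T ℕ.+ s ℕ.+ t) (sumℕ-1 n) (sumℕ-δ u d) ⟨
    T ℕ.+ sumℕ {n} (λ _ → 1) ℕ.+ sumℕ (λ v → [ u Fin.≟ v ] ℕ.* d v)
      ≡⟨ cong (ℕ._+ sumℕ (λ v → [ u Fin.≟ v ] ℕ.* d v)) (Σℕ.∑-distrib-+ (λ v → a u v ℕ.* d v) _) ⟨
    sumℕ (λ v → a u v ℕ.* d v ℕ.+ 1) ℕ.+ sumℕ (λ v → [ u Fin.≟ v ] ℕ.* d v)
      ≡⟨ Σℕ.∑-distrib-+ (λ v → a u v ℕ.* d v ℕ.+ 1) _ ⟨
    sumℕ (λ v → a u v ℕ.* d v ℕ.+ 1 ℕ.+ [ u Fin.≟ v ] ℕ.* d v)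
      ≤⟨ sumℕ-mono-≤ pointwise ⟩
    sumℕ (λ v → d v ℕ.+ [ u Fin.≟ v ] ℕ.+ a u v)
      ≡⟨ Σℕ.∑-distrib-+ (λ v → d v ℕ.+ [ u Fin.≟ v ]) _ ⟩
    sumℕ (λ v → d v ℕ.+ [ u Fin.≟ v ]) ℕ.+ d u
      ≡⟨ cong (ℕ._+ d u) (Σℕ.∑-distrib-+ d _) ⟩
    sumℕ d ℕ.+ sumℕ (λ v → [ u Fin.≟ v ]) ℕ.+ d u
      ≡⟨ cong (λ s → sumℕ d ℕ.+ s ℕ.+ d u) (sumℕ-δ-1 u) ⟩
    sumℕ d ℕ.+ 1 ℕ.+ d u ∎)
    where
    open ℕ.≤-Reasoning
    T = neighbourDegreeSum u
    open ℕ.+-*-Solver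
    -- The added `d u` appears as `[ u ≟ v ] * d v` on the left and as the row entry `a u v` on the
    -- right. Equality holds at `u` and at its neighbours; all other vertices use `1 ≤ d v`.
    pointwise : ∀ v → a u v ℕ.* d v ℕ.+ 1 ℕ.+ [ u Fin.≟ v ] ℕ.* d v ℕ.≤ d v ℕ.+ [ u Fin.≟ v ] ℕ.+ a u v
    pointwise v with u Fin.≟ v | adj? u v
    ... | yes u≡v | yes uv = contradiction uv (irrefl u≡v)
    ... | yes _   | no _   = ℕ.≤-reflexive (solve 1 (λ x → con 1 :+ (x :+ con 0) := x :+ con 1 :+ con 0) refl (d v))
    ... | no _    | yes _  = ℕ.≤-reflexive (solve 1 (λ x → (x :+ con 0) :+ con 1 :+ con 0 := x :+ con 0 :+ con 1) refl (d v))
    ... | no _    | no _   = ℕ.≤-trans (1≤d v) (ℕ.≤-reflexive (solve 1 (λ x → x := x :+ con 0 :+ con 0) refl (d v)))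

  -- Connectedness and the number of edges

  path⇒1≤degree : ∀ {u v} → Star Adj u v → u ≢ v → 1 ℕ.≤ d u
  path⇒1≤degree ε u≢u = contradiction refl u≢u
  path⇒1≤degree {u} (_◅_ {j = w} uw _) _ = ℕ.≤-trans ([yes] (adj? u w) uw) (term≤sumℕ (a u) w)

  connected⇒1≤degree : 2 ℕ.≤ n → Connected G → ∀ u → 1 ℕ.≤ d u
  connected⇒1≤degree (s≤s (s≤s _)) conn Fin.zero    = path⇒1≤degree (conn Fin.zero (Fin.suc Fin.zero)) λ ()
  connected⇒1≤degree (s≤s (s≤s _)) conn (Fin.suc u) = path⇒1≤degree (conn (Fin.suc u) Fin.zero) λ ()

  -- For the indicator vector s of a vertex set, twice the number of edges it spans.
  spanned : Vector ℕ n → ℕ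
  spanned s = sumℕ λ u → sumℕ λ v → s u ℕ.* s v ℕ.* a u v

  -- Walk along the path: the first edge whose far end has value 0 leaves the support of `s`.
  crossing : ∀ (s : Vector ℕ n) {u v} → Star Adj u v → 1 ℕ.≤ s u → s v ≡ 0 →
    ∃[ x ] ∃[ y ] (Adj x y × 1 ℕ.≤ s x × s y ≡ 0)
  crossing s ε 1≤s s≡0 = contradiction (subst (1 ℕ.≤_) s≡0 1≤s) λ ()
  crossing s (_◅_ {i = u} {j = w} uw p) 1≤su sv≡0 with s w in sw
  ... | zero  = u , w , uw , 1≤su , sw
  ... | suc _ = crossing s p (subst (1 ℕ.≤_) (sym sw) (s≤s z≤n)) sv≡0

  -- In the expansion of the product with the new indicator added, each of the two mixed terms sums
  -- to `r`, the `s`-weighted number of neighbours of `y`, and `x` makes `r` at least 1. The square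
  -- of the indicator is discarded.
  spanned-extend : ∀ s x y → Adj x y → 1 ℕ.≤ s x →
    spanned s ℕ.+ 2 ℕ.≤ spanned (λ u → s u ℕ.+ [ y Fin.≟ u ])
  spanned-extend s x y xy 1≤sx = begin
    spanned s ℕ.+ 2
      ≤⟨ ℕ.+-monoʳ-≤ (spanned s) (ℕ.+-mono-≤ 1≤r 1≤r) ⟩
    spanned s ℕ.+ (r ℕ.+ r)
      ≡⟨ cong (spanned s ℕ.+_) (cong₂ ℕ._+_ new-row (trans new-row (Σℕ.∑-comm (λ u v → δ u ℕ.* (s v ℕ.* a u v))))) ⟩
    spanned s ℕ.+ (sumℕ (λ u → sumℕ (λ v → δ u ℕ.* (s v ℕ.* a u v)))
               ℕ.+ sumℕ (λ u → sumℕ (λ v → δ v ℕ.* (s u ℕ.* a v u))))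
      ≡⟨ cong (spanned s ℕ.+_) (Σ²-+ (λ u v → δ u ℕ.* (s v ℕ.* a u v)) (λ u v → δ v ℕ.* (s u ℕ.* a v u))) ⟨
    spanned s ℕ.+ sumℕ (λ u → sumℕ (λ v → δ u ℕ.* (s v ℕ.* a u v) ℕ.+ δ v ℕ.* (s u ℕ.* a v u)))
      ≡⟨ Σ²-+ (λ u v → s u ℕ.* s v ℕ.* a u v) (λ u v → δ u ℕ.* (s v ℕ.* a u v) ℕ.+ δ v ℕ.* (s u ℕ.* a v u)) ⟨
    sumℕ (λ u → sumℕ (λ v → s u ℕ.* s v ℕ.* a u v ℕ.+ (δ u ℕ.* (s v ℕ.* a u v) ℕ.+ δ v ℕ.* (s u ℕ.* a v u))))
      ≤⟨ sumℕ-mono-≤ (λ u → sumℕ-mono-≤ (pointwise u)) ⟩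
    spanned (λ u → s u ℕ.+ δ u) ∎
    where
    open ℕ.≤-Reasoning
    δ : Vector ℕ n
    δ u = [ y Fin.≟ u ]

    r : ℕ
    r = sumℕ λ v → s v ℕ.* a y v

    1≤r : 1 ℕ.≤ r
    1≤r = ℕ.≤-trans (ℕ.*-mono-≤ 1≤sx ([yes] (adj? y x) (symm xy))) (term≤sumℕ (λ v → s v ℕ.* a y v) x)

    Σ²-+ : ∀ (f g : Matrix ℕ n) → sumℕ (λ u → sumℕ (λ v → f u v ℕ.+ g u v))
           ≡ sumℕ (λ u → sumℕ (f u)) ℕ.+ sumℕ (λ u → sumℕ (g u))
    Σ²-+ f g = trans (Σℕ.sum-cong-≗ λ u → Σℕ.∑-distrib-+ (f u) (g u)) (Σℕ.∑-distrib-+ (λ u → sumℕ (f u)) _)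

    new-row : r ≡ sumℕ (λ u → sumℕ (λ v → δ u ℕ.* (s v ℕ.* a u v)))
    new-row = trans (sym (sumℕ-δ y (λ u → sumℕ λ v → s v ℕ.* a u v)))
      (Σℕ.sum-cong-≗ λ u → Σℕ.*-distribˡ-sum (δ u) (λ v → s v ℕ.* a u v))

    pointwise : ∀ u v → s u ℕ.* s v ℕ.* a u v ℕ.+ (δ u ℕ.* (s v ℕ.* a u v) ℕ.+ δ v ℕ.* (s u ℕ.* a v u))
                        ℕ.≤ (s u ℕ.+ δ u) ℕ.* (s v ℕ.+ δ v) ℕ.* a u v
    -- The second mixed term carries the transposed entry `a v u`; symmetry brings both terms to
    -- `a u v`.
    pointwise u v rewrite adjacencyMatrix-sym v u = ℕ.≤-trans (ℕ.m≤m+n _ (δ u ℕ.* δ v ℕ.* a u v))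
      (ℕ.≤-reflexive (solve 5 (λ s t d e b →
        s :* t :* b :+ (d :* (t :* b) :+ e :* (s :* b)) :+ d :* e :* b := (s :+ d) :* (t :+ e) :* b)
        refl (s u) (s v) (δ u) (δ v) (a u v)))
      where open ℕ.+-*-Solver

  -- Grows a vertex set in place of a spanning tree: while some vertex is outside, a path to it from
  -- the recorded member `r` crosses the boundary, and the vertex reached there brings a new edge.
  connected-subset : Connected G → Fin n → ∀ k → k ℕ.< n →
    ∃[ s ] ((∀ u → s u ℕ.≤ 1) × sumℕ s ≡ suc k × 2 ℕ.* k ℕ.≤ spanned s × ∃[ r ] 1 ℕ.≤ s r)
  connected-subset conn o zero _ = (λ u → [ o Fin.≟ u ]) , (λ u → []≤1 (o Fin.≟ u)) , sumℕ-δ-1 o , z≤n , o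
    , ℕ.≤-reflexive (sym ([]-yes (o Fin.≟ o) refl))
  connected-subset conn o (suc k) k<n with connected-subset conn o k (ℕ.<⇒≤ k<n)
  ... | s , s≤1 , Σs≡ , 2k≤ , r , 1≤sr with Fin.all? (λ u → 1 ℕ.≤? s u)
  -- A set containing every vertex would force `n ≤ suc k`.
  ... | yes 1≤s = contradiction k<n (ℕ.≤⇒≯ (begin
    n                     ≡⟨ sumℕ-1 n ⟨
    sumℕ {n} (λ _ → 1)    ≤⟨ sumℕ-mono-≤ 1≤s ⟩
    sumℕ s                ≡⟨ Σs≡ ⟩
    suc k                 ∎))
    where open ℕ.≤-Reasoning
  ... | no ¬1≤s with Fin.¬∀⟶∃¬ n (λ u → 1 ℕ.≤ s u) (λ u → 1 ℕ.≤? s u) ¬1≤s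
  ... | v , 1≰sv with crossing s (conn r v) 1≤sr (ℕ.n<1⇒n≡0 (ℕ.≰⇒> 1≰sv))
  ... | x , y , xy , 1≤sx , sy≡0 =
    (λ u → s u ℕ.+ [ y Fin.≟ u ]) , bound
    , trans (Σℕ.∑-distrib-+ s _) (trans (cong₂ ℕ._+_ Σs≡ (sumℕ-δ-1 y)) (ℕ.+-comm (suc k) 1))
    , (begin
        2 ℕ.* suc k        ≡⟨ trans (ℕ.*-suc 2 k) (ℕ.+-comm 2 (2 ℕ.* k)) ⟩
        2 ℕ.* k ℕ.+ 2      ≤⟨ ℕ.+-monoˡ-≤ 2 2k≤ ⟩
        spanned s ℕ.+ 2    ≤⟨ spanned-extend s x y xy 1≤sx ⟩
        spanned (λ u → s u ℕ.+ [ y Fin.≟ u ]) ∎)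
    , r , ℕ.≤-trans 1≤sr (ℕ.m≤m+n _ _)
    where
    open ℕ.≤-Reasoning
    bound : ∀ u → s u ℕ.+ [ y Fin.≟ u ] ℕ.≤ 1
    bound u with y Fin.≟ u
    ... | yes refl = ℕ.≤-reflexive (cong (ℕ._+ 1) sy≡0)
    ... | no _     = ℕ.≤-trans (ℕ.≤-reflexive (ℕ.+-identityʳ _)) (s≤1 u)

  -- At `k = n - 1` the grown set spans at least `n - 1` edges, and an indicator vector spans at
  -- most all of them.
  connected⇒n∸1≤size : Fin n → Connected G → n ℕ.∸ 1 ℕ.≤ size G
  connected⇒n∸1≤size o conn =
    let s , s≤1 , _ , 2[n∸1]≤ , _ = connected-subset conn o (n ℕ.∸ 1) (ℕ.≤-reflexive (ℕ.m+[n∸m]≡n 1≤n))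
    in ℕ.*-cancelˡ-≤ 2 (begin
      2 ℕ.* (n ℕ.∸ 1)           ≤⟨ 2[n∸1]≤ ⟩
      spanned s                 ≤⟨ sumℕ-mono-≤ (λ u → sumℕ-mono-≤ λ v →
                                     ℕ.*-monoˡ-≤ (a u v) (ℕ.*-mono-≤ (s≤1 u) (s≤1 v))) ⟩
      sumℕ (λ u → sumℕ (λ v → 1 ℕ.* a u v))
                                ≡⟨ Σℕ.sum-cong-≗ (λ u → Σℕ.sum-cong-≗ λ v → ℕ.*-identityˡ (a u v)) ⟩
      sumℕ d                    ≡⟨ handshake ⟩
      size G ℕ.+ size G         ≡⟨ cong (size G ℕ.+_) (ℕ.+-identityʳ (size G)) ⟨
      2 ℕ.* size G              ∎)
    where
    open ℕ.≤-Reasoning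
    1≤n : 1 ℕ.≤ n
    1≤n = ℕ.≤-trans (s≤s z≤n) (Fin.toℕ<n o)

-- The degree inequality

-- For d ≥ 2 the difference of the two sides is at least
-- N (N − d) (d − 1) + (m − N) ((N + 1) d − 2 N) ≥ 0.
degree-inequality : ∀ {N m d T} → N ℕ.≤ m → 1 ℕ.≤ d → d ℕ.≤ N → T ℕ.≤ d ℕ.* N →
  T ℕ.+ N ℕ.≤ m ℕ.+ m → N ℕ.* (d ℕ.* d ℕ.+ T) ℕ.≤ suc N ℕ.* m ℕ.* d
-- At `d = 1` the second product would be `(m - N) (1 - N)`, which can be negative; `T ≤ N` and
-- `N ≤ m` suffice instead.
degree-inequality {N} {m} {suc zero} {T} N≤m _ _ T≤ _ = begin
  N ℕ.* (1 ℕ.+ T)           ≤⟨ ℕ.*-mono-≤ N≤m (s≤s (ℕ.≤-trans T≤ (ℕ.≤-reflexive (ℕ.*-identityˡ N)))) ⟩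
  m ℕ.* suc N               ≡⟨ ℕ.*-comm m (suc N) ⟩
  suc N ℕ.* m               ≡⟨ ℕ.*-identityʳ (suc N ℕ.* m) ⟨
  suc N ℕ.* m ℕ.* 1         ∎
  where open ℕ.≤-Reasoning
degree-inequality {N} {m} {d@(suc (suc k))} {T} N≤m _ d≤N _ T+N≤
  -- With `f = m - N` and `e = N - d` the difference is written without subtraction, and the claim
  -- becomes a polynomial identity.
  with ℕ.m≤n⇒∃[o]m+o≡n N≤m | ℕ.m≤n⇒∃[o]m+o≡n d≤N
... | f , refl | e , refl = begin
  N ℕ.* (d ℕ.* d ℕ.+ T)
    ≤⟨ ℕ.*-monoʳ-≤ N (ℕ.+-monoʳ-≤ (d ℕ.* d) T≤) ⟩
  N ℕ.* (d ℕ.* d ℕ.+ (N ℕ.+ 2 ℕ.* f))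
    ≤⟨ ℕ.m≤m+n _ _ ⟩
  N ℕ.* (d ℕ.* d ℕ.+ (N ℕ.+ 2 ℕ.* f)) ℕ.+ (N ℕ.* e ℕ.* (1 ℕ.+ k) ℕ.+ f ℕ.* (N ℕ.* k ℕ.+ k ℕ.+ 2))
    ≡⟨ solve 3 (λ k e f →
         let d = con 2 :+ k ; N = d :+ e in
         N :* (d :* d :+ (N :+ con 2 :* f)) :+ (N :* e :* (con 1 :+ k) :+ f :* (N :* k :+ k :+ con 2))
         := (con 1 :+ N) :* (N :+ f) :* d) refl k e f ⟩
  suc N ℕ.* (N ℕ.+ f) ℕ.* d ∎
  where
  open ℕ.≤-Reasoning
  open ℕ.+-*-Solver
  T≤ : T ℕ.≤ N ℕ.+ 2 ℕ.* f
  T≤ = ℕ.+-cancelʳ-≤ N _ _ (ℕ.≤-trans T+N≤ (ℕ.≤-reflexive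
    (solve 2 (λ N f → (N :+ f) :+ (N :+ f) := N :+ con 2 :* f :+ N) refl N f)))

connected⇒degree-inequality : ∀ {n} → 2 ℕ.≤ n → (G : Graph n) → Connected G → ∀ u →
  (n ℕ.∸ 1) ℕ.* (degree G u ℕ.* degree G u ℕ.+ neighbourDegreeSum G u) ℕ.≤ n ℕ.* size G ℕ.* degree G u
connected⇒degree-inequality {suc N} 2≤n G conn u = degree-inequality
  (connected⇒n∸1≤size G u conn)
  (connected⇒1≤degree G 2≤n conn u)
  (ℕ.s≤s⁻¹ (degree<n G u))
  (neighbourDegreeSum≤ G u)
  -- The bound on `T + n` is `2 m + 1`; as `n = suc N`, one successor cancels on each side.
  (ℕ.s≤s⁻¹ (begin
    suc (T ℕ.+ N)                 ≡⟨ ℕ.+-suc T N ⟨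
    T ℕ.+ suc N                   ≤⟨ neighbourDegreeSum+n≤ G (connected⇒1≤degree G 2≤n conn) u ⟩
    sumℕ (degree G) ℕ.+ 1         ≡⟨ ℕ.+-comm _ 1 ⟩
    suc (sumℕ (degree G))         ≡⟨ cong suc (handshake G) ⟩
    suc (size G ℕ.+ size G)       ∎))
  where
  open ℕ.≤-Reasoning
  T = neighbourDegreeSum G u

-- Null sequences and order on the reals

seq-sumℝ : ∀ {n} (f : Vector ℝ n) i → seq (sumℝ f) i ≡ sumℚ (λ u → seq (f u) i)
seq-sumℝ {zero}  f i = refl
seq-sumℝ {suc n} f i = cong (seq (f Fin.zero) i ℚ.+_) (seq-sumℝ (f ∘ Fin.suc) i)

-- `x ≈ y` unfolds to this property of the termwise difference.
Null : (ℕ → ℚ) → Set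
Null s = ∀ δ → 0ℚ ℚ.< δ → ∃[ N ] ∀ i → N ℕ.≤ i → ∣ s i ∣ ℚ.< δ

0<p*q : ∀ {p q} → 0ℚ ℚ.< p → 0ℚ ℚ.< q → 0ℚ ℚ.< p ℚ.* q
0<p*q {p} {q} 0<p 0<q = ℚ.positive⁻¹ (p ℚ.* q)
  {{ℚ.pos*pos⇒pos p {{ℚ.positive 0<p}} q {{ℚ.positive 0<q}}}}

reciprocal : ∀ {c} → 0ℚ ℚ.< c → ∃[ c′ ] (0ℚ ℚ.< c′ × c ℚ.* c′ ≡ 1ℚ)
reciprocal {c} 0<c = 1/ c , ℚ.positive⁻¹ (1/ c) {{ℚ.1/pos⇒pos c}} , ℚ.*-inverseʳ c
  where
  instance
    _ = ℚ.positive 0<c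
    _ = ℚ.pos⇒nonZero c

Null-+ : ∀ {s t} → Null s → Null t → Null (λ i → s i ℚ.+ t i)
Null-+ {s} {t} s→0 t→0 δ 0<δ =
  let M , s< = s→0 (½ ℚ.* δ) (half-pos 0<δ)
      N , t< = t→0 (½ ℚ.* δ) (half-pos 0<δ)
  in M ⊔ N , λ i ≤i → begin-strict
    ∣ s i ℚ.+ t i ∣              ≤⟨ ℚ.∣p+q∣≤∣p∣+∣q∣ (s i) (t i) ⟩
    ∣ s i ∣ ℚ.+ ∣ t i ∣          <⟨ ℚ.+-mono-< (s< i (ℕ.m⊔n≤o⇒m≤o M N ≤i)) (t< i (ℕ.m⊔n≤o⇒n≤o M N ≤i)) ⟩
    ½ ℚ.* δ ℚ.+ ½ ℚ.* δ          ≡⟨ halves δ ⟩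
    δ                            ∎
  where open ℚ.≤-Reasoning

Null-sum : ∀ {n} (f : Fin n → ℕ → ℚ) → (∀ u → Null (f u)) → Null (λ i → sumℚ (λ u → f u i))
Null-sum {zero}  f f→0 δ 0<δ = 0 , λ _ _ → 0<δ
Null-sum {suc n} f f→0 = Null-+ (f→0 Fin.zero) (Null-sum (f ∘ Fin.suc) (f→0 ∘ Fin.suc))

Null-* : ∀ {c s} → 0ℚ ℚ.< c → Null s → Null (λ i → c ℚ.* s i)
Null-* {c} {s} 0<c s→0 δ 0<δ =
  let c′ , 0<c′ , cc′≡1 = reciprocal 0<c
      N , s< = s→0 (c′ ℚ.* δ) (0<p*q 0<c′ 0<δ)
  in N , λ i ≤i → begin-strict
    ∣ c ℚ.* s i ∣        ≡⟨ ℚ.∣p*q∣≡∣p∣*∣q∣ c (s i) ⟩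
    ∣ c ∣ ℚ.* ∣ s i ∣    ≡⟨ cong (ℚ._* ∣ s i ∣) (ℚ.0≤p⇒∣p∣≡p (ℚ.<⇒≤ 0<c)) ⟩
    c ℚ.* ∣ s i ∣        <⟨ ℚ.*-monoʳ-<-pos c {{ℚ.positive 0<c}} (s< i ≤i) ⟩
    c ℚ.* (c′ ℚ.* δ)     ≡⟨ ℚ.*-assoc c c′ δ ⟨
    c ℚ.* c′ ℚ.* δ       ≡⟨ cong (ℚ._* δ) cc′≡1 ⟩
    1ℚ ℚ.* δ             ≡⟨ ℚ.*-identityˡ δ ⟩
    δ                    ∎
  where open ℚ.≤-Reasoning

Null-cong : ∀ {s t} → (∀ i → s i ≡ t i) → Null s → Null t
Null-cong s≡t s→0 δ 0<δ =
  let N , s< = s→0 δ 0<δ in N , λ i ≤i → subst (λ p → ∣ p ∣ ℚ.< δ) (s≡t i) (s< i ≤i)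

Null-∣∣ : ∀ {s} → Null s → Null (λ i → ∣ s i ∣)
Null-∣∣ {s} s→0 δ 0<δ =
  let N , s< = s→0 δ 0<δ in N , λ i ≤i → subst (ℚ._< δ) (sym (ℚ.∣∣p∣∣≡∣p∣ (s i))) (s< i ≤i)

seq-≡⇒≈ : ∀ x y → (∀ i → seq x i ≡ seq y i) → x ≈ y
seq-≡⇒≈ x y x≡y δ 0<δ = 0 , λ i _ →
  subst (λ p → ∣ p ∣ ℚ.< δ) (sym (trans (cong (ℚ._- seq y i) (x≡y i)) (ℚ.+-inverseʳ (seq y i)))) 0<δ

-- If `μ` eventually exceeds `C` by `δ`, then `weighted-residual` gives `δ * S ≤ R`, where `S` is
-- the weighted norm of `x` and `R` that of the residual. The eigenvalue equation makes `R` null, so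
-- every `x u` is null, contradicting `x≉0`.
weights⇒eigenvalue≤ : ∀ {n} (M : Matrix ℝ n) (A : Matrix ℚ n) → (∀ u v i → seq (M u v) i ≡ A u v) →
  (∀ u v → 0ℚ ℚ.≤ A u v) → (w : Vector ℚ n) → (∀ u → 0ℚ ℚ.< w u) →
  ∀ C → (∀ v → sumℚ (λ u → w u ℚ.* A u v) ℚ.≤ C ℚ.* w v) →
  ∀ μ → IsEigenvalue M μ → μ ≤ fromℚ C
weights⇒eigenvalue≤ {n} M A M≡A 0≤A w 0<w C wA≤Cw μ (x , x≉0 , Mx≈μx) (δ , 0<δ , N₀ , C+δ≤μ) =
  x≉0 λ u ε 0<ε →
    -- This tolerance leaves `ε` once the factors `δ` and `w u` are cancelled.
    let N₁ , R< = R→0 (δ ℚ.* (w u ℚ.* ε)) (0<p*q 0<δ (0<p*q (0<w u) 0<ε))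
    in N₀ ⊔ N₁ , λ i ≤i →
      subst (λ p → ∣ p ∣ ℚ.< ε) (sym (ℚ.+-identityʳ (seq (x u) i)))
        (ℚ.*-cancelˡ-<-nonNeg (w u) {{ℚ.nonNegative (ℚ.<⇒≤ (0<w u))}}
          (ℚ.*-cancelˡ-<-nonNeg δ {{ℚ.nonNegative (ℚ.<⇒≤ 0<δ)}} (begin-strict
            δ ℚ.* (w u ℚ.* ∣ seq (x u) i ∣)
              ≤⟨ ℚ.*-monoˡ-≤-nonNeg δ {{ℚ.nonNegative (ℚ.<⇒≤ 0<δ)}} (term≤sumℚ (0≤w∣x∣ i) u) ⟩
            δ ℚ.* S i
              ≤⟨ δS≤R i (ℕ.m⊔n≤o⇒m≤o N₀ N₁ ≤i) ⟩
            R i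
              ≤⟨ p≤∣p∣ (R i) ⟩
            ∣ R i ∣
              <⟨ R< i (ℕ.m⊔n≤o⇒n≤o N₀ N₁ ≤i) ⟩
            δ ℚ.* (w u ℚ.* ε) ∎)))
  where
  open ℚ.≤-Reasoning

  r : Fin n → ℕ → ℚ
  r u i = sumℚ (λ v → A u v ℚ.* seq (x v) i) ℚ.- seq μ i ℚ.* seq (x u) i

  R S : ℕ → ℚ
  R i = sumℚ λ u → w u ℚ.* ∣ r u i ∣
  S i = sumℚ λ u → w u ℚ.* ∣ seq (x u) i ∣

  r→0 : ∀ u → Null (r u)
  r→0 u = Null-cong (λ i → cong (ℚ._- seq μ i ℚ.* seq (x u) i)
    (trans (seq-sumℝ (λ v → M u v * x v) i)
           (Σℚ.sum-cong-≗ λ v → cong (ℚ._* seq (x v) i) (M≡A u v i)))) (Mx≈μx u)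

  R→0 : Null R
  R→0 = Null-sum (λ u i → w u ℚ.* ∣ r u i ∣) λ u → Null-* (0<w u) (Null-∣∣ {r u} (r→0 u))

  0≤w∣x∣ : ∀ i u → 0ℚ ℚ.≤ w u ℚ.* ∣ seq (x u) i ∣
  0≤w∣x∣ i u = ℚ.nonNegative⁻¹ _ {{ℚ.nonNeg*nonNeg⇒nonNeg
    (w u) {{ℚ.nonNegative (ℚ.<⇒≤ (0<w u))}} ∣ seq (x u) i ∣ {{ℚ.∣-∣-nonNeg (seq (x u) i)}}}}

  δS≤R : ∀ i → N₀ ℕ.≤ i → δ ℚ.* S i ℚ.≤ R i
  δS≤R i ≤i = begin
    δ ℚ.* S i
      ≡⟨ solve 3 (λ c d s → d :* s := (c :+ d) :* s :- c :* s) refl C δ (S i) ⟩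
    (C ℚ.+ δ) ℚ.* S i ℚ.- C ℚ.* S i
      ≤⟨ ℚ.+-monoˡ-≤ (ℚ.- (C ℚ.* S i)) (ℚ.*-monoʳ-≤-nonNeg (S i) {{ℚ.nonNegative (sumℚ-nonNeg (0≤w∣x∣ i))}} (C+δ≤μ i ≤i)) ⟩
    seq μ i ℚ.* S i ℚ.- C ℚ.* S i
      ≤⟨ ℚ.+-monoˡ-≤ (ℚ.- (C ℚ.* S i)) (weighted-residual A w C 0≤A (λ u → ℚ.<⇒≤ (0<w u)) wA≤Cw (λ u → seq (x u) i) (seq μ i)) ⟩
    R i ℚ.+ C ℚ.* S i ℚ.- C ℚ.* S i
      ≡⟨ solve 2 (λ r s → r :+ s :- s := r) refl (R i) (C ℚ.* S i) ⟩
    R i ∎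
    where open ℚ.+-*-Solver

-- Rational order is decidable, so a difference of at least `δ` at a late index `i` may be assumed.
-- Past the moduli for `δ / 4` each sequence moves by less than `δ / 4`, so a gap of `δ / 2`
-- persists at all late `j`: a strict inequality that one hypothesis refutes.
≤-antisym : ∀ {x y} → x ≤ y → y ≤ x → x ≈ y
≤-antisym {x} {y} x≤y y≤x δ 0<δ =
  let M , cx = cauchy x q 0<q
      N , cy = cauchy y q 0<q
      ≥M : ∀ {i} → M ⊔ N ℕ.≤ i → M ℕ.≤ i
      ≥M = ℕ.m⊔n≤o⇒m≤o M N
      ≥N : ∀ {i} → M ⊔ N ℕ.≤ i → N ℕ.≤ i
      ≥N = ℕ.m⊔n≤o⇒n≤o M N
  in M ⊔ N , λ i ≤i → ℚ.≰⇒> λ δ≤ → case-abs i δ≤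
    (λ δ≤x-y → x≤y (h , half-pos 0<δ , M ⊔ N , λ j ≤j → apart y x i j δ≤x-y
      (cy j i (≥N ≤j) (≥N ≤i)) (cx i j (≥M ≤i) (≥M ≤j))))
    (λ δ≤y-x → y≤x (h , half-pos 0<δ , M ⊔ N , λ j ≤j → apart x y i j δ≤y-x
      (cx j i (≥M ≤j) (≥M ≤i)) (cy i j (≥N ≤i) (≥N ≤j))))
  where
  open ℚ.≤-Reasoning
  open ℚ.+-*-Solver

  h q : ℚ
  h = ½ ℚ.* δ
  q = ½ ℚ.* h

  0<q : 0ℚ ℚ.< q
  0<q = half-pos (half-pos 0<δ)

  apart : ∀ x y i j → δ ℚ.≤ seq y i ℚ.- seq x i →
    ∣ seq x j ℚ.- seq x i ∣ ℚ.< q → ∣ seq y i ℚ.- seq y j ∣ ℚ.< q → seq x j ℚ.+ h ℚ.≤ seq y j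
  apart x y i j δ≤ xj-xi< yi-yj< = begin
    xj ℚ.+ h
      ≡⟨ solve 3 (λ xi xj h → xj :+ h := (xj :- xi) :+ ((h :+ h) :+ (xi :- h))) refl xi xj h ⟩
    (xj ℚ.- xi) ℚ.+ ((h ℚ.+ h) ℚ.+ (xi ℚ.- h))
      ≤⟨ ℚ.+-mono-≤ (ℚ.≤-trans (p≤∣p∣ _) (ℚ.<⇒≤ xj-xi<))
           (ℚ.+-monoˡ-≤ (xi ℚ.- h) (ℚ.≤-trans (ℚ.≤-reflexive (halves δ)) δ≤)) ⟩
    q ℚ.+ ((yi ℚ.- xi) ℚ.+ (xi ℚ.- h))
      ≡⟨ cong (λ t → q ℚ.+ ((yi ℚ.- xi) ℚ.+ (xi ℚ.- t))) (halves h) ⟨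
    q ℚ.+ ((yi ℚ.- xi) ℚ.+ (xi ℚ.- (q ℚ.+ q)))
      ≡⟨ solve 4 (λ xi yi yj q → q :+ ((yi :- xi) :+ (xi :- (q :+ q))) := (yi :- yj) :+ (yj :- q)) refl xi yi yj q ⟩
    (yi ℚ.- yj) ℚ.+ (yj ℚ.- q)
      ≤⟨ ℚ.+-monoˡ-≤ (yj ℚ.- q) (ℚ.≤-trans (p≤∣p∣ _) (ℚ.<⇒≤ yi-yj<)) ⟩
    q ℚ.+ (yj ℚ.- q)
      ≡⟨ solve 2 (λ yj q → q :+ (yj :- q) := yj) refl yj q ⟩
    yj ∎
    where
    xi = seq x i
    xj = seq x j
    yi = seq y i
    yj = seq y j

  case-abs : ∀ i {P : Set} → δ ℚ.≤ ∣ seq x i ℚ.- seq y i ∣ →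
    (δ ℚ.≤ seq x i ℚ.- seq y i → P) → (δ ℚ.≤ seq y i ℚ.- seq x i → P) → P
  case-abs i δ≤ f g with ℚ.∣p∣≡p∨∣p∣≡-p (seq x i ℚ.- seq y i)
  ... | inj₁ ∣p∣≡p  = f (subst (δ ℚ.≤_) ∣p∣≡p δ≤)
  ... | inj₂ ∣p∣≡-p = g (subst (δ ℚ.≤_) (trans ∣p∣≡-p
    (solve 2 (λ a b → :- (a :- b) := b :- a) refl (seq x i) (seq y i))) δ≤)

-- A gap `δ` above `c * C` becomes a gap `δ / c` above `C` on dividing by `c`.
scale-≤ : ∀ {c} → 0ℚ ℚ.< c → ∀ x y C → (∀ i → seq y i ≡ c ℚ.* seq x i) →
  x ≤ fromℚ C → y ≤ fromℚ (c ℚ.* C)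
scale-≤ {c} 0<c x y C y≡cx x≤C (δ , 0<δ , N , cC+δ≤y) =
  let c′ , 0<c′ , cc′≡1 = reciprocal 0<c
  in x≤C (c′ ℚ.* δ , 0<p*q 0<c′ 0<δ , N , λ i ≤i →
    ℚ.*-cancelˡ-≤-pos c {{ℚ.positive 0<c}} (begin
      c ℚ.* (C ℚ.+ c′ ℚ.* δ)         ≡⟨ solve 4 (λ c c′ C δ → c :* (C :+ c′ :* δ) := c :* C :+ c :* c′ :* δ) refl c c′ C δ ⟩
      c ℚ.* C ℚ.+ c ℚ.* c′ ℚ.* δ     ≡⟨ cong (λ t → c ℚ.* C ℚ.+ t ℚ.* δ) cc′≡1 ⟩
      c ℚ.* C ℚ.+ 1ℚ ℚ.* δ           ≡⟨ cong (c ℚ.* C ℚ.+_) (ℚ.*-identityˡ δ) ⟩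
      c ℚ.* C ℚ.+ δ                  ≤⟨ cC+δ≤y i ≤i ⟩
      seq y i                        ≡⟨ y≡cx i ⟩
      c ℚ.* seq x i                  ∎))
  where
  open ℚ.≤-Reasoning
  open ℚ.+-*-Solver

scale-≈ : ∀ {c} → 0ℚ ℚ.< c → ∀ x y C → (∀ i → seq y i ≡ c ℚ.* seq x i) →
  x ≈ fromℚ C → y ≈ fromℚ (c ℚ.* C)
scale-≈ {c} 0<c x y C y≡cx x≈C = Null-cong
  (λ i → trans (solve 3 (λ c x C → c :* (x :- C) := c :* x :- c :* C) refl c (seq x i) C)
               (cong (ℚ._- c ℚ.* C) (sym (y≡cx i))))
  (Null-* 0<c x≈C)
  where open ℚ.+-*-Solver

-- Eigenvalue bound for the signless Laplacian

signlessLaplacianℕ : ∀ {n} → Graph n → Matrix ℕ n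
signlessLaplacianℕ G u v = degreeMatrix G u v ℕ.+ adjacencyMatrix G u v

signlessLaplacianℕ-sym : ∀ {n} (G : Graph n) u v → signlessLaplacianℕ G u v ≡ signlessLaplacianℕ G v u
signlessLaplacianℕ-sym G u v = cong₂ ℕ._+_ degreeMatrix-sym (adjacencyMatrix-sym G u v)
  where
  degreeMatrix-sym : degreeMatrix G u v ≡ degreeMatrix G v u
  degreeMatrix-sym with u Fin.≟ v
  ... | yes refl = cong (ℕ._* degree G u) (sym ([]-yes (u Fin.≟ u) refl))
  ... | no u≢v   = cong (ℕ._* degree G v) (sym ([]-no (v Fin.≟ u) (u≢v ∘ sym)))

-- The diagonal part collapses to one term. The result is the quantity bounded by the degree
-- inequality.
signlessLaplacianℕ-*-degree : ∀ {n} (G : Graph n) u →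
  sumℕ (λ v → signlessLaplacianℕ G u v ℕ.* degree G v) ≡ degree G u ℕ.* degree G u ℕ.+ neighbourDegreeSum G u
signlessLaplacianℕ-*-degree G u = begin
  sumℕ (λ v → signlessLaplacianℕ G u v ℕ.* d v)
    ≡⟨ Σℕ.sum-cong-≗ (λ v → trans
         (ℕ.*-distribʳ-+ (d v) (degreeMatrix G u v) (adjacencyMatrix G u v))
         (cong (ℕ._+ adjacencyMatrix G u v ℕ.* d v) (ℕ.*-assoc [ u Fin.≟ v ] (d u) (d v)))) ⟩
  sumℕ (λ v → [ u Fin.≟ v ] ℕ.* (d u ℕ.* d v) ℕ.+ adjacencyMatrix G u v ℕ.* d v)
    ≡⟨ Σℕ.∑-distrib-+ (λ v → [ u Fin.≟ v ] ℕ.* (d u ℕ.* d v)) _ ⟩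
  sumℕ (λ v → [ u Fin.≟ v ] ℕ.* (d u ℕ.* d v)) ℕ.+ neighbourDegreeSum G u
    ≡⟨ cong (ℕ._+ neighbourDegreeSum G u) (sumℕ-δ u (λ v → d u ℕ.* d v)) ⟩
  d u ℕ.* d u ℕ.+ neighbourDegreeSum G u ∎
  where
  open ≡-Reasoning
  d = degree G

seq-signlessLaplacian : ∀ {n} (G : Graph n) u v i →
  seq (signlessLaplacian G u v) i ≡ ι (signlessLaplacianℕ G u v)
seq-signlessLaplacian G u v i = sym (ι-+ (degreeMatrix G u v) (adjacencyMatrix G u v))

-- Multiplied by `n / (4 m)` this gives the claimed bound on `γ`, since the edge count cancels.
-- Matching on `2 ≤ n` exposes `n - 1` as a successor.
eigenvalueBound : ∀ {n} → 2 ℕ.≤ n → Graph n → ℚ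
eigenvalueBound {n@(suc (suc k))} (s≤s (s≤s _)) G = ι (n ℕ.* size G) ℚ.* (+ 1 ℚ./ suc k)

eigenvalue≤ : ∀ {n} (2≤n : 2 ℕ.≤ n) (G : Graph n) → Connected G →
  ∀ μ → IsEigenvalue (signlessLaplacian G) μ → μ ≤ fromℚ (eigenvalueBound 2≤n G)
eigenvalue≤ {n@(suc (suc k))} 2≤n@(s≤s (s≤s _)) G conn = weights⇒eigenvalue≤
  (signlessLaplacian G) (λ u v → ι (signlessLaplacianℕ G u v)) (seq-signlessLaplacian G)
  (λ u v → 0≤ι (signlessLaplacianℕ G u v)) (ι ∘ d) (λ u → 0<ι (d u) {{ℕ.>-nonZero (connected⇒1≤degree G 2≤n conn u)}})
  C column
  where
  open ℚ.≤-Reasoning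
  N = suc k
  d = degree G
  C = eigenvalueBound 2≤n G
  r = + 1 ℚ./ N

  column : ∀ v → sumℚ (λ u → ι (d u) ℚ.* ι (signlessLaplacianℕ G u v)) ℚ.≤ C ℚ.* ι (d v)
  column v = begin
    sumℚ (λ u → ι (d u) ℚ.* ι (signlessLaplacianℕ G u v))
      -- The weights act from the left; symmetry turns column `v` into row `v` applied to the
      -- degrees.
      ≡⟨ Σℚ.sum-cong-≗ (λ u → trans (sym (ι-* (d u) (signlessLaplacianℕ G u v)))
           (cong ι (trans (ℕ.*-comm (d u) _) (cong (ℕ._* d u) (signlessLaplacianℕ-sym G u v))))) ⟩
    sumℚ (λ u → ι (signlessLaplacianℕ G v u ℕ.* d u))
      ≡⟨ ι-sum (λ u → signlessLaplacianℕ G v u ℕ.* d u) ⟨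
    ι (sumℕ (λ u → signlessLaplacianℕ G v u ℕ.* d u))
      ≡⟨ cong ι (signlessLaplacianℕ-*-degree G v) ⟩
    ι s
      ≡⟨ ℚ.*-identityˡ (ι s) ⟨
    1ℚ ℚ.* ι s
      -- Inserting `1 = r * N` produces the factor `N` of the degree inequality.
      ≡⟨ cong (ℚ._* ι s) (trans (sym (ι-*-1/ N)) (ℚ.*-comm (ι N) r)) ⟩
    r ℚ.* ι N ℚ.* ι s
      ≡⟨ trans (ℚ.*-assoc r (ι N) (ι s)) (cong (r ℚ.*_) (sym (ι-* N s))) ⟩
    r ℚ.* ι (N ℕ.* s)
      ≤⟨ ℚ.*-monoˡ-≤-nonNeg r {{ℚ.nonNegative (ℚ.<⇒≤ (0<1/ N))}} (ι-mono-≤ (connected⇒degree-inequality 2≤n G conn v)) ⟩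
    r ℚ.* ι (n ℕ.* size G ℕ.* d v)
      ≡⟨ cong (r ℚ.*_) (ι-* (n ℕ.* size G) (d v)) ⟩
    r ℚ.* (ι (n ℕ.* size G) ℚ.* ι (d v))
      ≡⟨ solve 3 (λ r a b → r :* (a :* b) := a :* r :* b) refl r (ι (n ℕ.* size G)) (ι (d v)) ⟩
    C ℚ.* ι (d v) ∎
    where
    open ℚ.+-*-Solver
    s = d v ℕ.* d v ℕ.+ neighbourDegreeSum G v

-- From the eigenvalue to `γ`

γ-factor : ∀ {n} (G : Graph n) .{{_ : NonZero (size G)}} → ℚ
γ-factor {n} G = ι n ℚ.* (+ 1 ℚ./ (4 ℕ.* size G)) {{ℕ.m*n≢0 4 (size G)}}

0<γ-factor : ∀ {n} → 2 ℕ.≤ n → (G : Graph n) .{{_ : NonZero (size G)}} → 0ℚ ℚ.< γ-factor G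
0<γ-factor {n} (s≤s (s≤s _)) G = 0<p*q (0<ι n) (0<1/ (4 ℕ.* size G) {{ℕ.m*n≢0 4 (size G)}})

seq-γ : ∀ {n} (G : Graph n) .{{_ : NonZero (size G)}} q i → seq (γ G q) i ≡ γ-factor G ℚ.* seq q i
seq-γ {n} G q i = solve 3 (λ q n s → q :* n :* s := n :* s :* q) refl
  (seq q i) (ι n) ((+ 1 ℚ./ (4 ℕ.* size G)) {{ℕ.m*n≢0 4 (size G)}})
  where open ℚ.+-*-Solver

γ-factor-*-eigenvalueBound : ∀ {n} (2≤n : 2 ℕ.≤ n) (G : Graph n) .{{_ : NonZero (size G)}} →
  γ-factor G ℚ.* eigenvalueBound 2≤n G
    ≡ ι (n ℕ.^ 2) ℚ.* (+ 1 ℚ./ (4 ℕ.* (n ℕ.∸ 1))) {{4[n∸1]≢0 2≤n}}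
γ-factor-*-eigenvalueBound {n@(suc (suc k))} (s≤s (s≤s _)) G = begin
  ι n ℚ.* s ℚ.* (ι (n ℕ.* m) ℚ.* r)
    ≡⟨ ℚ.*-identityʳ _ ⟨
  ι n ℚ.* s ℚ.* (ι (n ℕ.* m) ℚ.* r) ℚ.* 1ℚ
    -- The factor 1 is expanded as `4 * N * s′`, so that regrouping leaves `4 * m * s` and `N * r`,
    -- both equal to 1.
    ≡⟨ cong₂ (λ x y → ι n ℚ.* s ℚ.* (x ℚ.* r) ℚ.* y) (ι-* n m)
         (trans (sym (ι-*-1/ (4 ℕ.* N))) (cong (ℚ._* s′) (ι-* 4 N))) ⟩
  ι n ℚ.* s ℚ.* (ι n ℚ.* ι m ℚ.* r) ℚ.* (ι 4 ℚ.* ι N ℚ.* s′)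
    ≡⟨ solve 7 (λ n s m r f N s′ → n :* s :* (n :* m :* r) :* (f :* N :* s′)
         := (f :* m :* s) :* (N :* r) :* (n :* n :* s′)) refl (ι n) s (ι m) r (ι 4) (ι N) s′ ⟩
  (ι 4 ℚ.* ι m ℚ.* s) ℚ.* (ι N ℚ.* r) ℚ.* (ι n ℚ.* ι n ℚ.* s′)
    ≡⟨ cong₂ (λ x y → x ℚ.* y ℚ.* (ι n ℚ.* ι n ℚ.* s′))
         (trans (cong (ℚ._* s) (sym (ι-* 4 m))) (ι-*-1/ (4 ℕ.* m) {{ℕ.m*n≢0 4 m}})) (ι-*-1/ N) ⟩
  1ℚ ℚ.* 1ℚ ℚ.* (ι n ℚ.* ι n ℚ.* s′)
    ≡⟨ ℚ.*-identityˡ _ ⟩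
  ι n ℚ.* ι n ℚ.* s′
    ≡⟨ cong (ℚ._* s′) (trans (sym (ι-* n n)) (cong (λ t → ι (n ℕ.* t)) (sym (ℕ.*-identityʳ n)))) ⟩
  ι (n ℕ.^ 2) ℚ.* s′ ∎
  where
  open ≡-Reasoning
  open ℚ.+-*-Solver
  N = suc k
  m = size G
  r = + 1 ℚ./ N
  s = (+ 1 ℚ./ (4 ℕ.* m)) {{ℕ.m*n≢0 4 m}}
  s′ = + 1 ℚ./ (4 ℕ.* N)

-- Star graphs

module _ (N : ℕ) where
  private
    K = starGraph (suc N)

  -- Adjacency depends only on which index is 0, so on constructors the rows compute: the centre row
  -- is 0 followed by 1s, a leaf row 1 followed by 0s.
  degree-centre : degree K Fin.zero ≡ N
  degree-centre = sumℕ-1 N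

  degree-leaf : ∀ u → degree K (Fin.suc u) ≡ 1
  degree-leaf u = cong suc (Σℕ.sum-replicate-zero N)

  -- The degrees `N` and `N` times 1 add up to `2 N`, and `handshake` converts this into the edge
  -- count.
  size-starGraph : size K ≡ N
  size-starGraph = ℕ.*-cancelˡ-≡ (size K) N 2 (begin
    2 ℕ.* size K                                   ≡⟨ cong (size K ℕ.+_) (ℕ.+-identityʳ (size K)) ⟩
    size K ℕ.+ size K                              ≡⟨ handshake K ⟨
    degree K Fin.zero ℕ.+ sumℕ (λ u → degree K (Fin.suc u))
      ≡⟨ cong₂ ℕ._+_ degree-centre (trans (Σℕ.sum-cong-≗ degree-leaf) (sumℕ-1 N)) ⟩
    N ℕ.+ N                                        ≡⟨ cong (N ℕ.+_) (ℕ.+-identityʳ N) ⟨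
    2 ℕ.* N                                        ∎)
    where open ≡-Reasoning

  -- The centre gives `N * N + N` and a leaf gives `1 + N`.
  starGraph-degree-eigenvector : ∀ u →
    degree K u ℕ.* degree K u ℕ.+ neighbourDegreeSum K u ≡ suc N ℕ.* degree K u
  starGraph-degree-eigenvector Fin.zero = begin
    degree K Fin.zero ℕ.* degree K Fin.zero ℕ.+ sumℕ (λ v → 1 ℕ.* degree K (Fin.suc v))
      ≡⟨ cong₂ (λ x y → x ℕ.* x ℕ.+ y) degree-centre
           (trans (Σℕ.sum-cong-≗ λ v → trans (ℕ.*-identityˡ _) (degree-leaf v)) (sumℕ-1 N)) ⟩
    N ℕ.* N ℕ.+ N               ≡⟨ ℕ.+-comm (N ℕ.* N) N ⟩
    suc N ℕ.* N                 ≡⟨ cong (suc N ℕ.*_) degree-centre ⟨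
    suc N ℕ.* degree K Fin.zero ∎
    where open ≡-Reasoning
  starGraph-degree-eigenvector (Fin.suc u) = begin
    degree K (Fin.suc u) ℕ.* degree K (Fin.suc u) ℕ.+ (1 ℕ.* degree K Fin.zero ℕ.+ sumℕ {N} (λ v → 0))
      ≡⟨ cong₂ (λ x y → x ℕ.* x ℕ.+ y) (degree-leaf u)
           (trans (cong₂ ℕ._+_ (trans (ℕ.*-identityˡ _) degree-centre) (Σℕ.sum-replicate-zero N)) (ℕ.+-identityʳ N)) ⟩
    suc N                            ≡⟨ ℕ.*-identityʳ (suc N) ⟨
    suc N ℕ.* 1                      ≡⟨ cong (suc N ℕ.*_) (degree-leaf u) ⟨
    suc N ℕ.* degree K (Fin.suc u)   ∎
    where open ≡-Reasoning

starGraph-eigenvalueBound : ∀ n (2≤n : 2 ℕ.≤ n) → eigenvalueBound 2≤n (starGraph n) ≡ ι n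
starGraph-eigenvalueBound n@(suc (suc k)) (s≤s (s≤s _)) = begin
  ι (n ℕ.* size (starGraph n)) ℚ.* r    ≡⟨ cong (λ m → ι (n ℕ.* m) ℚ.* r) (size-starGraph N) ⟩
  ι (n ℕ.* N) ℚ.* r                     ≡⟨ trans (cong (ℚ._* r) (ι-* n N)) (ℚ.*-assoc (ι n) (ι N) r) ⟩
  ι n ℚ.* (ι N ℚ.* r)                   ≡⟨ cong (ι n ℚ.*_) (ι-*-1/ N) ⟩
  ι n ℚ.* 1ℚ                            ≡⟨ ℚ.*-identityʳ (ι n) ⟩
  ι n                                   ∎
  where
  open ≡-Reasoning
  N = suc k
  r = + 1 ℚ./ N

starGraph-eigenvalue : ∀ n → 2 ℕ.≤ n → IsEigenvalue (signlessLaplacian (starGraph n)) (fromℕ n)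
starGraph-eigenvalue n@(suc N@(suc k)) (s≤s (s≤s _)) =
  (λ u → fromℕ (d u)) , nonzero , λ u → seq-≡⇒≈
    ((signlessLaplacian K *ᵥ (λ u → fromℕ (d u))) u) (fromℕ n * fromℕ (d u)) (row u)
  where
  K = starGraph n
  d = degree K

  nonzero : ¬ (∀ u → fromℕ (d u) ≈ fromℕ 0)
  nonzero d≈0 =
    -- The centre has degree `N ≥ 1`, so tolerance 1 already gives a contradiction.
    let M , d<1 = d≈0 Fin.zero 1ℚ (ℚ.positive⁻¹ 1ℚ)
    in ℚ.<-irrefl refl (begin-strict
      1ℚ                               ≤⟨ ι-mono-≤ {1} {N} (s≤s z≤n) ⟩
      ι N                              ≡⟨ cong ι (degree-centre N) ⟨
      ι (d Fin.zero)                   ≡⟨ ℚ.+-identityʳ _ ⟨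
      ι (d Fin.zero) ℚ.- 0ℚ            ≤⟨ p≤∣p∣ _ ⟩
      ∣ ι (d Fin.zero) ℚ.- 0ℚ ∣        <⟨ d<1 M ℕ.≤-refl ⟩
      1ℚ                               ∎)
    where open ℚ.≤-Reasoning

  row : ∀ u i → seq ((signlessLaplacian K *ᵥ (λ u → fromℕ (d u))) u) i ≡ ι n ℚ.* ι (d u)
  row u i = begin
    seq ((signlessLaplacian K *ᵥ (λ u → fromℕ (d u))) u) i
      ≡⟨ seq-sumℝ (λ v → signlessLaplacian K u v * fromℕ (d v)) i ⟩
    sumℚ (λ v → seq (signlessLaplacian K u v) i ℚ.* ι (d v))
      ≡⟨ Σℚ.sum-cong-≗ (λ v → trans (cong (ℚ._* ι (d v)) (seq-signlessLaplacian K u v i))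
           (sym (ι-* (signlessLaplacianℕ K u v) (d v)))) ⟩
    sumℚ (λ v → ι (signlessLaplacianℕ K u v ℕ.* d v))
      ≡⟨ ι-sum (λ v → signlessLaplacianℕ K u v ℕ.* d v) ⟨
    ι (sumℕ (λ v → signlessLaplacianℕ K u v ℕ.* d v))
      ≡⟨ cong ι (trans (signlessLaplacianℕ-*-degree K u) (starGraph-degree-eigenvector N u)) ⟩
    ι (n ℕ.* d u)
      ≡⟨ ι-* n (d u) ⟩
    ι n ℚ.* ι (d u) ∎
    where open ≡-Reasoning

-- The bound on `γ` and equality for stars

γ-bound : ∀ {n} (2≤n : 2 ℕ.≤ n) → ℝ
γ-bound {n} 2≤n = _÷_ (fromℕ (n ℕ.^ 2)) (4 ℕ.* (n ℕ.∸ 1)) {{4[n∸1]≢0 2≤n}}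

γ≤ : ∀ n (2≤n : 2 ℕ.≤ n) (G : Graph n) (conn : Connected G) q →
  IsEigenvalue (signlessLaplacian G) q → γ G {{connected⇒size≢0 2≤n G conn}} q ≤ γ-bound 2≤n
γ≤ n 2≤n G conn q eig = subst (λ K → γ G q ≤ fromℚ K) (γ-factor-*-eigenvalueBound 2≤n G)
  (scale-≤ (0<γ-factor 2≤n G) q (γ G q) (eigenvalueBound 2≤n G) (seq-γ G q) (eigenvalue≤ 2≤n G conn q eig))
  where instance _ = connected⇒size≢0 2≤n G conn

-- For the star `eigenvalueBound` is `n` itself, and the degree vector attains it.
starGraph-largestEigenvalue : ∀ n → 2 ℕ.≤ n → IsLargestEigenvalue (signlessLaplacian (starGraph n)) (fromℕ n)
starGraph-largestEigenvalue n 2≤n = starGraph-eigenvalue n 2≤n , λ μ eig →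
  subst (λ C → μ ≤ fromℚ C) (starGraph-eigenvalueBound n 2≤n)
    (eigenvalue≤ 2≤n (starGraph n) (starGraph-connected n) μ eig)

-- The general bound gives `q ≤ n`, and maximality of `q` against the eigenvalue `n` gives `n ≤ q`.
-- Antisymmetry yields `q ≈ n`, and scaling by `γ-factor` preserves the equality.
γ-starGraph : ∀ n (2≤n : 2 ℕ.≤ n) q → IsLargestEigenvalue (signlessLaplacian (starGraph n)) q →
  γ (starGraph n) {{connected⇒size≢0 2≤n (starGraph n) (starGraph-connected n)}} q ≈ γ-bound 2≤n
γ-starGraph n 2≤n q (eig , largest) =
  subst (λ K → γ G q ≈ fromℚ K) (γ-factor-*-eigenvalueBound 2≤n G)
    (scale-≈ (0<γ-factor 2≤n G) q (γ G q) (eigenvalueBound 2≤n G) (seq-γ G q)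
      (≤-antisym {q} {fromℚ (eigenvalueBound 2≤n G)} (eigenvalue≤ 2≤n G (starGraph-connected n) q eig)
        (subst (λ C → fromℚ C ≤ q) (sym (starGraph-eigenvalueBound n 2≤n))
          (largest (fromℕ n) (starGraph-eigenvalue n 2≤n)))))
  where
  G = starGraph n
  instance _ = connected⇒size≢0 2≤n (starGraph n) (starGraph-connected n)

theorem7 : (∀ n (2≤n : 2 ℕ.≤ n) (G : Graph n) (conn : Connected G) (q : ℝ) →
    IsLargestEigenvalue (signlessLaplacian G) q →
    γ G {{connected⇒size≢0 2≤n G conn}} q
    ≤ _÷_ (fromℕ (n ℕ.^ 2)) (4 ℕ.* (n ℕ.∸ 1)) {{4[n∸1]≢0 2≤n}})
    ×
    (∀ n (2≤n : 2 ℕ.≤ n) →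
    IsLargestEigenvalue (signlessLaplacian (starGraph n)) (fromℕ n)
    ×
    (∀ q → IsLargestEigenvalue (signlessLaplacian (starGraph n)) q →
    γ (starGraph n) {{connected⇒size≢0 2≤n (starGraph n) (starGraph-connected n)}} q
    ≈ _÷_ (fromℕ (n ℕ.^ 2)) (4 ℕ.* (n ℕ.∸ 1)) {{4[n∸1]≢0 2≤n}}))
theorem7 = (λ n 2≤n G conn q (eig , _) → γ≤ n 2≤n G conn q eig)
  , λ n 2≤n → starGraph-largestEigenvalue n 2≤n , γ-starGraph n 2≤n
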